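{- The $3$-MDA problem (Minimum Diameter-$3$ Augmentation) is solvable in polynomial time. That is, there is a polynomial-time algorithm which, given a connected graph $G$ and a positive integer $k$, decides whether there is a set $F\subseteq E(G)$ such that $|F|\le k$ and $G-F$ is a connected graph of diameter at least $3$.
   Context: All graphs are finite, simple and undirected. For $F\subseteq E(G)$, $G-F$ is the graph with vertex set $V(G)$ and edge set $E(G)\setminus F$. The diameter of a connected graph $G$ is $\mathrm{diam}(G)=\max_{u,v\in V(G)}\mathrm{dist}_G(u,v)$, where $\mathrm{dist}_G(u,v)$ is the minimum number of edges of a $u,v$-path. For a fixed positive integer $d$, the Minimum Diameter-$d$ Augmentation problem ($d$-MDA) is the following decision problem. Input: a connected graph $G$ and a positive integer $k$. Question: is there a set $F\subseteq E(G)$ such that $|F|\le k$ and $G-F$ is a connected graph of diameter at least $d$? -}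

module Defs where

open import Data.Bool.Base using (Bool; false; _∧_; not; T; if_then_else_)
open import Data.Digit using (Bit; 0b; 1b; toDigits)
open import Data.Fin.Base using (Fin; _<_)
open import Data.Fin.Properties using (_<?_)
open import Data.List.Base
  using (List; []; _∷_; _++_; map; length; filter; replicate; allFin; cartesianProduct)
open import Data.List.Relation.Unary.Unique.Propositional using (Unique)
open import Data.Nat.Base using (ℕ; suc; _+_; _*_; _^_; _≤_; NonZero)
open import Data.Product.Base using (Σ; _×_; _,_; proj₁; proj₂; ∃-syntax)
open import Data.Sum.Base using (_⊎_; inj₁; inj₂)
open import Data.Vec.Base as Vec using (Vec)
open import Function.Bundles using (_↔_)
open import Relation.Binary.Construct.Closure.ReflexiveTransitive using (Star; ε; _◅_)
open import Relation.Binary.PropositionalEquality using (_≡_; cong; cong₂)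
open import Relation.Nullary.Decidable using (_×-dec_; T?)
open import Relation.Nullary.Reflects using (Reflects)

-- A set of two-element subsets of Fin n, given by its (symmetric,
-- irreflexive) characteristic function.

record EdgeSet (n : ℕ) : Set where
  field
    has    : Fin n → Fin n → Bool
    sym    : ∀ u v → has u v ≡ has v u
    irrefl : ∀ u → has u u ≡ false

open EdgeSet public using (has)

-- Every undirected edge is counted once, as the pair (u , v) with u < v.

∣_∣ : ∀ {n} → EdgeSet n → ℕ
∣_∣ {n} F = length (filter (λ (u , v) → (u <? v) ×-dec T? (has F u v))
                           (cartesianProduct (allFin n) (allFin n)))

_⊆_ : ∀ {n} → EdgeSet n → EdgeSet n → Set
F ⊆ E = ∀ u v → T (has F u v) → T (has E u v)

_∖_ : ∀ {n} → EdgeSet n → EdgeSet n → EdgeSet n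
E ∖ F = record
  { has    = λ u v → has E u v ∧ not (has F u v)
  ; sym    = λ u v → cong₂ (λ a b → a ∧ not b) (EdgeSet.sym E u v) (EdgeSet.sym F u v)
  ; irrefl = λ u → cong (_∧ not (has F u u)) (EdgeSet.irrefl E u)
  }

-- At least one vertex is required, so that the diameter (a maximum over
-- pairs of vertices) makes sense.

record Graph : Set where
  field
    order     : ℕ
    {{order≢0}} : NonZero order
    edges     : EdgeSet order

  Vertex : Set
  Vertex = Fin order

  Adjacent : Vertex → Vertex → Set
  Adjacent u v = T (has edges u v)

  Walk : Vertex → Vertex → Set
  Walk = Star Adjacent

open Graph public using (order; edges; Vertex; Walk)

_−_ : (G : Graph) → EdgeSet (order G) → Graph
G − F = record { order = order G ; order≢0 = Graph.order≢0 G ; edges = edges G ∖ F }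

module _ (G : Graph) where

  vertices : ∀ {u v} → Walk G u v → List (Vertex G)
  vertices {u} ε       = u ∷ []
  vertices {u} (_ ◅ w) = u ∷ vertices w

  edgeCount : ∀ {u v} → Walk G u v → ℕ
  edgeCount ε       = 0
  edgeCount (_ ◅ w) = suc (edgeCount w)

  record Path (u v : Vertex G) : Set where
    field
      walk     : Walk G u v
      distinct : Unique (vertices walk)

  pathLength : ∀ {u v} → Path u v → ℕ
  pathLength p = edgeCount (Path.walk p)

  Connected : Set
  Connected = ∀ u v → Path u v

  IsDistance : Vertex G → Vertex G → ℕ → Set
  IsDistance u v d = (Σ (Path u v) λ p → pathLength p ≡ d)
                   × (∀ (p : Path u v) → d ≤ pathLength p)

  IsDiameter : ℕ → Set
  IsDiameter D = (∃[ u ] ∃[ v ] IsDistance u v D)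
               × (∀ u v d → IsDistance u v d → d ≤ D)

data Symbol (m : ℕ) : Set where
  blank : Symbol m
  bit   : Bit → Symbol m
  aux   : Fin m → Symbol m

data Move : Set where
  left stay right : Move

-- A tape that is infinite in both directions.  The lists hold the cells
-- on either side of the head, nearest cell first; all cells beyond the
-- end of a list are blank.

record Tape (m : ℕ) : Set where
  constructor tape
  field
    before : List (Symbol m)
    head   : Symbol m
    after  : List (Symbol m)

module _ {m : ℕ} where

  write : Symbol m → Tape m → Tape m
  write a (tape ls _ rs) = tape ls a rs

  move : Move → Tape m → Tape m
  move stay  t                    = t
  move left  (tape []       a rs) = tape [] blank (a ∷ rs)
  move left  (tape (l ∷ ls) a rs) = tape ls l (a ∷ rs)
  move right (tape ls a [])       = tape (a ∷ ls) blank []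
  move right (tape ls a (r ∷ rs)) = tape (a ∷ ls) r rs

  blankTape : Tape m
  blankTape = tape [] blank []

  inputTape : List Bit → Tape m
  inputTape []       = blankTape
  inputTape (b ∷ bs) = tape [] (bit b) (map bit bs)

-- From the state and the scanned symbols, the transition function either
-- halts with an answer (true: accept, false: reject), or gives the next
-- state and, for each tape, the symbol to write and the head move.

record TuringMachine : Set₁ where
  field
    State      : Set
    stateCount : ℕ
    finite     : State ↔ Fin stateCount
    auxSymbols : ℕ
    workTapes  : ℕ

  Sym : Set
  Sym = Symbol auxSymbols

  tapes : ℕ
  tapes = suc workTapes

  field
    start : State
    δ     : State → Vec Sym tapes → Bool ⊎ (State × Vec (Sym × Move) tapes)

module Run (M : TuringMachine) where
  open TuringMachine M

  record Config : Set where
    constructor config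
    field
      state    : State
      contents : Vec (Tape auxSymbols) tapes

  scan : Config → Bool ⊎ (State × Vec (Sym × Move) tapes)
  scan (config q ts) = δ q (Vec.map Tape.head ts)

  act : Sym × Move → Tape auxSymbols → Tape auxSymbols
  act (a , d) t = move d (write a t)

  -- c ⇓[ t ] b : started from c, the machine makes t steps and then
  -- halts with answer b.

  data _⇓[_]_ (c : Config) : ℕ → Bool → Set where
    halt : ∀ {b} → scan c ≡ inj₁ b → c ⇓[ 0 ] b
    step : ∀ {q as t b} → scan c ≡ inj₂ (q , as) →
           config q (Vec.zipWith act as (Config.contents c)) ⇓[ t ] b →
           c ⇓[ suc t ] b

  initial : List Bit → Config
  initial bs = config start (inputTape bs Vec.∷ Vec.replicate workTapes blankTape)

record DecisionProblem : Set₁ where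
  field
    Instance : Set
    encode   : Instance → List Bit
    Yes      : Instance → Set

-- One machine and one bound a · ℓ ^ e + a, with ℓ the length of the
-- encoding, work for all instances.

PolynomialTime : DecisionProblem → Set₁
PolynomialTime P =
  Σ TuringMachine λ M → let open Run M in
  ∃[ a ] ∃[ e ] ∀ (x : Instance) →
    ∃[ t ] ∃[ b ] (t ≤ a * length (encode x) ^ e + a)
                × (initial (encode x) ⇓[ t ] b)
                × Reflects (Yes x) b
  where open DecisionProblem P

record MDAInstance : Set where
  field
    graph     : Graph
    connected : Connected graph
    k         : ℕ
    {{k≢0}}   : NonZero k

boolToBit : Bool → Bit
boolToBit b = if b then 1b else 0b

-- The order in unary, terminated by 0.

encodeOrder : ℕ → List Bit
encodeOrder n = replicate n 1b ++ 0b ∷ []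

-- The adjacency matrix, row by row.

encodeEdges : ∀ {n} → EdgeSet n → List Bit
encodeEdges {n} E =
  map (λ (u , v) → boolToBit (has E u v)) (cartesianProduct (allFin n) (allFin n))

-- Binary, least significant digit first.

encodeℕ : ℕ → List Bit
encodeℕ k = proj₁ (toDigits 2 k)

encodeMDA : MDAInstance → List Bit
encodeMDA I = encodeOrder (order graph) ++ encodeEdges (edges graph) ++ encodeℕ k
  where open MDAInstance I

MDA : (d : ℕ) .{{_ : NonZero d}} → DecisionProblem
MDA d = record
  { Instance = MDAInstance
  ; encode   = encodeMDA
  ; Yes      = λ I → let open MDAInstance I in
      Σ (EdgeSet (order graph)) λ F →
          F ⊆ edges graph
        × ∣ F ∣ ≤ k
        × Connected (graph − F)
        × (∃[ D ] IsDiameter (graph − F) D × d ≤ D)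
  }

{-# OPTIONS --safe #-}

-- To make the distance of u and v at least 3 one must delete the edge uv, if
-- present, and for every common neighbour w one of uw, wv.  If G − F has
-- diameter at least 3, the last four vertices u a b v of a geodesic of length
-- at least 3 are a path whose ends are at distance exactly 3 in G − F, so
-- [uv ∈ E] + |N(u) ∩ N(v)| ≤ |F|.  Conversely, let u a b v be a path in G with
-- u ≠ v, u ≠ b, a ≠ v.  Delete uv, delete uw for every common neighbour w ≠ a,
-- and delete va if a is a common neighbour.  The path u a b v survives, and it
-- reconnects the ends of every deleted edge.  So the answer is yes exactly if
-- some such path has [uv ∈ E] + |N(u) ∩ N(v)| ≤ k, and a Turing machine can try
-- all quadruples (u , a , b , v).
--
-- The machine writes its tapes only at the beginning; after that the head
-- positions serve as registers.

module Submission where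

open import Data.Bool.Base as Bool using (Bool; true; false; not; _∧_; _∨_; if_then_else_)
open import Data.Bool.Properties using (not-injective; T-∧; T-∨; ∨-comm; T?)
open import Data.Digit using (Bit; 0b; 1b; fromDigits; toDigits)
open import Data.Fin.Base as Fin using (Fin; zero; suc; toℕ)
open import Data.Fin.Patterns
import Data.Fin.Properties as Fin
open import Data.List.Base as List
  using (List; []; _∷_; _++_; length; allFin; tabulate; filter; cartesianProduct)
open import Data.List.Properties
  using ( length-++; length-map; length-replicate; length-tabulate
        ; map-++; map-∘; map-replicate; map-tabulate; ++-assoc)
open import Data.List.Membership.Propositional using (_∈_)
open import Data.List.Membership.Propositional.Properties
  using ( ∈-allFin; ∈-cartesianProduct⁺; ∈-filter⁺; ∈-filter⁻; ∈-lookup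
        ; ∈-map⁺; ∈-map⁻; ∈-++⁺ˡ; ∈-++⁺ʳ; ∈-++⁻)
import Data.List.Membership.Setoid.Properties as Membership
open import Data.List.Relation.Unary.All as All using (All; []; _∷_)
open import Data.List.Relation.Unary.AllPairs using (AllPairs; []; _∷_)
import Data.List.Relation.Unary.AllPairs.Properties as AllPairs
open import Data.List.Relation.Unary.Any using (here; there; index; any?)
open import Data.List.Relation.Unary.Unique.Propositional using (Unique)
open import Data.List.Relation.Unary.Unique.Propositional.Properties
  using (allFin⁺; cartesianProduct⁺; filter⁺; ++⁺)
open import Data.Nat.Base
open import Data.Nat.Properties
open import Data.Nat.Tactic.RingSolver using (solve-∀)
open import Data.Product.Base using (Σ; _×_; _,_; proj₁; proj₂; ∃-syntax; map₁; map₂)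
open import Data.Sum.Base using (_⊎_; inj₁; inj₂; [_,_]′)
open import Data.Sum.Function.Propositional using (_⊎-↔_)
open import Data.Unit.Base using (⊤; tt)
open import Data.Vec.Base as Vec using (Vec; []; _∷_; lookup; updateAt; _[_]≔_)
open import Data.Vec.Properties
  using ( lookup∘updateAt; lookup∘tabulate; updateAt-updateAt; updateAt-updateAt-local
        ; updateAt-id-local; updateAt-cong-local; []≔-idempotent; []≔-lookup
        ; lookup-zipWith; lookup-map)
open import Function.Base using (_∘_; const)
open import Function.Bundles using (_↔_; Equivalence)
open import Function.Properties.Inverse using (↔-sym; ↔-trans)
open import Relation.Binary.Construct.Closure.ReflexiveTransitive using (ε; _◅_; _◅◅_; reverse)
open import Relation.Binary.Definitions using (tri<; tri≈; tri>)
open import Relation.Binary.PropositionalEquality hiding ([_])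
open import Relation.Nullary using (¬_; Dec; yes; no; does; contradiction)
open import Relation.Nullary.Decidable using (_×-dec_; _⊎-dec_; map′; toWitness; fromWitness; isYes)
open import Relation.Nullary.Reflects using (Reflects; fromEquivalence)
open import Defs

-- Two sizes shape the machine. The order `n` is given in unary, so registers with values up to
-- `n + 1` can be driven by loops with linearly many rounds. The budget `k` is given in binary and
-- may be exponential in the length of the input, so counting up to `k` is out of reach. But a
-- common neighbour of `u` and `v` is different from `u`, so no pair needs more than `n` deletions,
-- and `min n k` is as good a budget as `k`; the capped arithmetic of `readBudget` computes this
-- minimum. Time is not followed step by step. The semantics of programs only demands that every
-- loop makes at most `L` rounds; the running time is then bounded by a polynomial in `L` that is
-- read off from the syntax. Both directions of the equivalence compare `F` with one kind of edge
-- list: `uv`, if present, and one edge at every common neighbour. Given a solution, the ends of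
-- these edges are chosen so that the list lies inside `F`; given a path, they are chosen so that
-- the path survives, and the list covers `F`.

-- Structured programs and their translation into Turing machines

module Programs (m w : ℕ) where

  Sym : Set
  Sym = Symbol m

  Heads Tapes Action : Set
  Heads  = Vec Sym (suc w)
  Tapes  = Vec (Tape m) (suc w)
  Action = Vec (Sym × Move) (suc w)

  heads : ∀ {n} → Vec (Tape m) n → Vec Sym n
  heads = Vec.map Tape.head

  perform : ∀ {n} → Vec (Sym × Move) n → Vec (Tape m) n → Vec (Tape m) n
  perform = Vec.zipWith (λ (a , d) t → move d (write a t))

  idle : ∀ {n} → Vec Sym n → Vec (Sym × Move) n
  idle = Vec.map (_, stay)

  perform-idle : ∀ {n} (ts : Vec (Tape m) n) → perform (idle (heads ts)) ts ≡ ts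
  perform-idle []       = refl
  perform-idle (t ∷ ts) = cong (t ∷_) (perform-idle ts)

  infixr 5 _⨾_

  data Prog : Set where
    act    : (Heads → Action) → Prog
    _⨾_    : Prog → Prog → Prog
    branch : (Heads → Bool) → Prog → Prog → Prog
    while  : (Heads → Bool) → Prog → Prog

  -- Every loop makes at most L iterations.

  module _ (L : ℕ) where

    mutual
      data Exec : Prog → Tapes → Tapes → Set where
        act    : ∀ {f ts} → Exec (act f) ts (perform (f (heads ts)) ts)
        _⨾_    : ∀ {p q ts ts₁ ts₂} → Exec p ts ts₁ → Exec q ts₁ ts₂ → Exec (p ⨾ q) ts ts₂
        branch : ∀ {c p q ts ts₁} → Exec (if c (heads ts) then p else q) ts ts₁ →
                 Exec (branch c p q) ts ts₁
        while  : ∀ {c p n ts ts₁} → Loop c p n ts ts₁ → n ≤ L → Exec (while c p) ts ts₁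

      data Loop (c : Heads → Bool) (p : Prog) : ℕ → Tapes → Tapes → Set where
        stop  : ∀ {ts} → c (heads ts) ≡ false → Loop c p 0 ts ts
        again : ∀ {n ts ts₁ ts₂} → c (heads ts) ≡ true → Exec p ts ts₁ →
                Loop c p n ts₁ ts₂ → Loop c p (suc n) ts ts₂

  -- Besides atomic actions only `branch` and `while` own a state, used for the test. A sequence
  -- enters its second part in the very step that leaves the first.
  State : Prog → Set
  State (act f)        = ⊤
  State (p ⨾ q)        = State p ⊎ State q
  State (branch c p q) = ⊤ ⊎ (State p ⊎ State q)
  State (while c p)    = ⊤ ⊎ State p

  stateCount : Prog → ℕ
  stateCount (act f)        = 1
  stateCount (p ⨾ q)        = stateCount p + stateCount q
  stateCount (branch c p q) = 1 + (stateCount p + stateCount q)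
  stateCount (while c p)    = 1 + stateCount p

  infixr 4 _⊎-finite_

  _⊎-finite_ : ∀ {A B : Set} {i j} → A ↔ Fin i → B ↔ Fin j → (A ⊎ B) ↔ Fin (i + j)
  f ⊎-finite g = ↔-trans (f ⊎-↔ g) (↔-sym Fin.+↔⊎)

  finite : ∀ p → State p ↔ Fin (stateCount p)
  finite (act f)        = ↔-sym Fin.1↔⊤
  finite (p ⨾ q)        = finite p ⊎-finite finite q
  finite (branch c p q) = ↔-sym Fin.1↔⊤ ⊎-finite (finite p ⊎-finite finite q)
  finite (while c p)    = ↔-sym Fin.1↔⊤ ⊎-finite finite p

  entry : ∀ p → State p
  entry (act f)        = tt
  entry (p ⨾ q)        = inj₁ (entry p)
  entry (branch c p q) = inj₁ tt
  entry (while c p)    = inj₁ tt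

  -- inj₂ tt stands for having left the program.

  Control : Prog → Set
  Control p = State p ⊎ ⊤

  redirect : ∀ {A B : Set} → (A → B) → B ⊎ ⊤ → A ⊎ ⊤ → B ⊎ ⊤
  redirect ι κ = [ inj₁ ∘ ι , const κ ]′

  next : ∀ p → State p → Heads → Control p × Action
  next (act f)        _               hs = inj₂ tt , f hs
  next (p ⨾ q)        (inj₁ s)        hs = map₁ (redirect inj₁ (inj₁ (inj₂ (entry q)))) (next p s hs)
  next (p ⨾ q)        (inj₂ s)        hs = map₁ (redirect inj₂ (inj₂ tt)) (next q s hs)
  next (branch c p q) (inj₁ tt)       hs =
    inj₁ (inj₂ (if c hs then inj₁ (entry p) else inj₂ (entry q))) , idle hs
  next (branch c p q) (inj₂ (inj₁ s)) hs = map₁ (redirect (inj₂ ∘ inj₁) (inj₂ tt)) (next p s hs)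
  next (branch c p q) (inj₂ (inj₂ s)) hs = map₁ (redirect (inj₂ ∘ inj₂) (inj₂ tt)) (next q s hs)
  next (while c p)    (inj₁ tt)       hs =
    (if c hs then inj₁ (inj₂ (entry p)) else inj₂ tt) , idle hs
  next (while c p)    (inj₂ s)        hs = map₁ (redirect inj₂ (inj₁ (inj₁ tt))) (next p s hs)

  data Steps (p : Prog) : Control p → Tapes → ℕ → Tapes → Set where
    exit : ∀ {ts} → Steps p (inj₂ tt) ts 0 ts
    step : ∀ {s ts n ts₁} → (let (s₁ , a) = next p s (heads ts)) →
           Steps p s₁ (perform a ts) n ts₁ → Steps p (inj₁ s) ts (suc n) ts₁

  -- The simulation behind all composite programs: `ι` places the states of `p` among those of `q`,
  -- and leaving `p` means going on at `κ`. As transitions agree up to this renaming, a run of `p`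
  -- becomes a run of `q` with equally many steps.
  embed : ∀ p q (ι : State p → State q) κ →
          (∀ s hs → next q (ι s) hs ≡ map₁ (redirect ι κ) (next p s hs)) →
          ∀ {x ts n ts₁ n′ ts₂} → Steps p x ts n ts₁ → Steps q κ ts₁ n′ ts₂ →
          Steps q (redirect ι κ x) ts (n + n′) ts₂
  embed p q ι κ eq exit             rest = rest
  embed p q ι κ eq {ts = ts} {n = suc n} {n′ = n′} {ts₂ = ts₂} (step {s} steps) rest =
    step (subst (λ (y , a) → Steps q y (perform a ts) (n + n′) ts₂)
                (sym (eq s (heads ts)))
                (embed p q ι κ eq steps rest))

  -- Both branches are charged, which spares a maximum. A loop pays one test per round and one more
  -- for the test that fails.
  time : Prog → ℕ → ℕ
  time (act f)        L = 1
  time (p ⨾ q)        L = time p L + time q L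
  time (branch c p q) L = suc (time p L + time q L)
  time (while c p)    L = suc (L * suc (time p L))

  module _ {L : ℕ} where

    mutual
      steps : ∀ {p ts ts₁} → Exec L p ts ts₁ →
              ∃[ n ] n ≤ time p L × Steps p (inj₁ (entry p)) ts n ts₁
      steps act = 1 , ≤-refl , step exit
      steps {p ⨾ q} (e ⨾ f) with steps e | steps f
      ... | i , i≤ , s | j , j≤ , t =
        i + j , +-mono-≤ i≤ j≤ ,
        embed p (p ⨾ q) inj₁ _ (λ _ _ → refl) s
          (subst (λ n → Steps (p ⨾ q) _ _ n _) (+-identityʳ j)
            (embed q (p ⨾ q) inj₂ _ (λ _ _ → refl) t exit))
      steps {branch c p q} {ts} {ts₁} (branch e)
        with c (heads ts) in eq
      ... | true with steps e
      ...   | i , i≤ , s =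
        suc (i + 0) , s≤s (+-mono-≤ i≤ z≤n) ,
        step (subst₂ (λ b us → Steps (branch c p q)
                        (inj₁ (inj₂ (if b then inj₁ (entry p) else inj₂ (entry q)))) us (i + 0) ts₁)
               (sym eq) (sym (perform-idle ts))
               (embed p (branch c p q) (inj₂ ∘ inj₁) _ (λ _ _ → refl) s exit))
      steps {branch c p q} {ts} {ts₁} (branch e) | false with steps e
      ...   | i , i≤ , s =
        suc (i + 0) , s≤s (≤-trans (+-monoˡ-≤ 0 i≤)
                            (≤-trans (≤-reflexive (+-comm (time q L) 0)) (m≤n+m _ (time p L)))) ,
        step (subst₂ (λ b us → Steps (branch c p q)
                        (inj₁ (inj₂ (if b then inj₁ (entry p) else inj₂ (entry q)))) us (i + 0) ts₁)
               (sym eq) (sym (perform-idle ts))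
               (embed q (branch c p q) (inj₂ ∘ inj₂) _ (λ _ _ → refl) s exit))
      steps {while c p} (while l n≤L) with loopSteps l
      ... | i , i≤ , s = i , ≤-trans i≤ (s≤s (*-monoˡ-≤ (suc (time p L)) n≤L)) , s

      loopSteps : ∀ {c p n ts ts₁} → Loop L c p n ts ts₁ →
                  ∃[ i ] i ≤ suc (n * suc (time p L))
                       × Steps (while c p) (inj₁ (inj₁ tt)) ts i ts₁
      loopSteps {c} {p} {ts = ts} (stop eq) =
        1 , s≤s z≤n ,
        step (subst₂ (λ b us → Steps (while c p) (if b then inj₁ (inj₂ (entry p)) else inj₂ tt) us 0 ts)
               (sym eq) (sym (perform-idle ts)) exit)
      loopSteps {c} {p} {n = suc n} {ts = ts} {ts₁} (again eq e l) with steps e | loopSteps l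
      ... | i , i≤ , s | j , j≤ , t =
        suc (i + j) ,
        s≤s (≤-trans (+-mono-≤ i≤ j≤) (≤-reflexive (+-suc (time p L) _))) ,
        step (subst₂ (λ b us → Steps (while c p) (if b then inj₁ (inj₂ (entry p)) else inj₂ tt) us (i + j) ts₁)
               (sym eq) (sym (perform-idle ts))
               (embed p (while c p) inj₂ _ (λ _ _ → refl) s t))

  machine : Prog → (Heads → Bool) → TuringMachine
  machine p answer = record
    { State      = Control p
    ; stateCount = stateCount p + 1
    ; finite     = finite p ⊎-finite ↔-sym Fin.1↔⊤
    ; auxSymbols = m
    ; workTapes  = w
    ; start      = inj₁ (entry p)
    ; δ          = λ { (inj₁ s) hs → inj₂ (next p s hs) ; (inj₂ _) hs → inj₁ (answer hs) }
    }

  runs : ∀ p answer {x ts n ts₁} → let open Run (machine p answer) in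
         Steps p x ts n ts₁ → config x ts ⇓[ n ] answer (heads ts₁)
  runs p answer exit     = Run.halt refl
  runs p answer (step s) = Run.step refl (runs p answer s)

  -- Powers of `suc L` are never zero, so they absorb additive constants, and they grow with the
  -- exponent, so two bounds can be raised to a common degree. Every loop costs one degree.
  time-poly : ∀ p → ∃[ a ] ∃[ e ] ∀ L → time p L ≤ a * suc L ^ e
  time-poly (act f) = 1 , 0 , λ L → ≤-refl
  time-poly (p ⨾ q) with time-poly p | time-poly q
  ... | a , e , p≤ | b , f , q≤ = a + b , e + f , λ L → begin
    time p L + time q L                              ≤⟨ +-mono-≤ (p≤ L) (q≤ L) ⟩
    a * suc L ^ e + b * suc L ^ f                    ≤⟨ +-mono-≤ (*-monoʳ-≤ a (^-monoʳ-≤ (suc L) (m≤m+n e f)))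
                                                                 (*-monoʳ-≤ b (^-monoʳ-≤ (suc L) (m≤n+m f e))) ⟩
    a * suc L ^ (e + f) + b * suc L ^ (e + f)        ≡⟨ *-distribʳ-+ (suc L ^ (e + f)) a b ⟨
    (a + b) * suc L ^ (e + f)                        ∎
    where open ≤-Reasoning
  time-poly (branch c p q) with time-poly (p ⨾ q)
  ... | a , e , pq≤ = suc a , e , λ L → +-mono-≤ (m^n>0 (suc L) e) (pq≤ L)
  time-poly (while c p) with time-poly p
  ... | a , e , p≤ = suc a , suc e , λ L → begin
    suc (L * suc (time p L))              ≤⟨ s≤s (m≤n+m _ (time p L)) ⟩
    suc L * suc (time p L)                ≤⟨ *-monoʳ-≤ (suc L) (+-mono-≤ (m^n>0 (suc L) e) (p≤ L)) ⟩
    suc L * (suc a * suc L ^ e)           ≡⟨ *-assoc (suc L) (suc a) (suc L ^ e) ⟨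
    suc L * suc a * suc L ^ e             ≡⟨ cong (_* suc L ^ e) (*-comm (suc L) (suc a)) ⟩
    suc a * suc L * suc L ^ e             ≡⟨ *-assoc (suc a) (suc L) (suc L ^ e) ⟩
    suc a * suc L ^ suc e                 ∎
    where open ≤-Reasoning


-- The program of the decider

module Decider where

  open Programs 3 10

  pattern first = aux 0F
  pattern mid   = aux 1F
  pattern end   = aux 2F

  isFirst isEnd isOne isBit : Sym → Bool
  isFirst first = true
  isFirst _     = false
  isEnd end = true
  isEnd _   = false
  isOne (bit 1F) = true
  isOne _        = false
  isBit (bit _) = true
  isBit _       = false

  shift : Fin 11 → Move → Prog
  shift j d = act (λ hs → updateAt (idle hs) j (map₂ (const d)))

  inc dec reset : Fin 11 → Prog
  inc j = shift j right
  dec j = shift j left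

  skip : Prog
  skip = act idle

  when : (Sym → Bool) → Fin 11 → Prog → Prog → Prog
  when c j = branch (λ hs → c (lookup hs j))

  whilst : (Sym → Bool) → Fin 11 → Prog → Prog
  whilst c j = while (λ hs → c (lookup hs j))

  reset j = whilst (not ∘ isFirst) j (dec j)

  pattern M = 0F
  pattern S = 1F
  pattern S′ = 2F

  reg : Fin 8 → Fin 11
  reg i = suc (suc (suc i))

  pattern U = 0F
  pattern V = 1F
  pattern A = 2F
  pattern B = 3F
  pattern W = 4F
  pattern C = 5F
  pattern K = 6F
  pattern F = 7F

  -- The register is counted down while `S` records the rounds, and is then refilled from `S`. In
  -- between both hold intermediate values, so `p` must work for any values of them and restore
  -- them; hence `row` sweeps with `S′`.
  times : Fin 8 → Prog → Prog
  times i p = whilst (not ∘ isFirst) (reg i) (dec (reg i) ⨾ inc S ⨾ p)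
            ⨾ whilst (not ∘ isFirst) S (dec S ⨾ inc (reg i))

  -- With vertices numbered from 1, and the first input cell (overwritten with
  -- first) as origin, entry (x , y) of the adjacency matrix is in cell n * x + y,
  -- and the binary number k starts in cell n * (n + 1) + 1.

  row : Prog
  row = inc S′ ⨾ whilst (not ∘ isEnd) S′ (inc M ⨾ inc S′) ⨾ reset S′

  goto : Fin 8 → Fin 8 → Prog
  goto i j = times i row ⨾ times j (inc M)

  ifAdjacent : Fin 8 → Fin 8 → Prog → Prog
  ifAdjacent i j p = goto i j ⨾ when isOne M (reset M ⨾ p) (reset M)

  -- Truncated subtraction decides the order: `S′` ends up at the second value minus the first,
  -- which is nonzero exactly if the first is smaller.
  ifLess : Fin 8 → Fin 8 → Prog → Prog → Prog
  ifLess i j p q = times j (inc S′) ⨾ times i (when isFirst S′ skip (dec S′))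
                 ⨾ when isFirst S′ q (reset S′ ⨾ p)

  ifDistinct : Fin 8 → Fin 8 → Prog → Prog
  ifDistinct i j p = ifLess i j p (ifLess j i p skip)

  -- The cells marked `mid` are numbered 1 to `n`, like the vertices; the mark `end` in cell `n + 1`
  -- stops the loop.
  for : Fin 8 → Prog → Prog
  for i p = inc (reg i) ⨾ whilst (not ∘ isEnd) (reg i) (p ⨾ inc (reg i)) ⨾ reset (reg i)

  spend : Prog
  spend = when isFirst (reg C) skip (dec (reg C))

  -- Register C is charged for every edge to delete; it starts at K + 1, so
  -- it stays positive exactly if the number of deletions is at most K.

  withinBudget : Prog
  withinBudget = times K (inc (reg C)) ⨾ inc (reg C)
               ⨾ ifAdjacent U V spend
               ⨾ for W (ifAdjacent U W (ifAdjacent W V spend))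
               ⨾ when isFirst (reg C) skip (when isFirst (reg F) (inc (reg F)) skip ⨾ reset (reg C))

  search : Prog
  search = for U (for V (for A (for B
    (ifAdjacent U A (ifAdjacent A B (ifAdjacent B V
    (ifDistinct U V (ifDistinct U B (ifDistinct A V withinBudget)))))))))

  capInc : Fin 8 → Prog
  capInc i = inc (reg i) ⨾ when isEnd (reg i) (dec (reg i)) skip

  addDigit : Prog
  addDigit = when isOne M (times W (capInc K)) skip
           -- The weight is doubled by way of a copy in `S′`, because a loop that counts `W` down
           -- cannot raise it at the same time.
           ⨾ times W (inc S′) ⨾ whilst (not ∘ isFirst) S′ (dec S′ ⨾ capInc W)
           ⨾ inc M

  -- Leaves min n k in K.  The weight of the current binary digit, also cut
  -- off at n, is in W.

  readBudget : Prog
  readBudget = inc (reg W) ⨾ inc (reg V) ⨾ inc (reg U)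
             ⨾ whilst (not ∘ isEnd) (reg U) (inc (reg U))
             -- With `n + 1` in `U` and 1 in `V` the address is `n * (n + 1) + 1`, the first binary
             -- digit.
             ⨾ goto U V
             ⨾ whilst isBit M addDigit
             ⨾ reset M ⨾ reset (reg U) ⨾ reset (reg V) ⨾ reset (reg W)

  writeAll : (Sym → Sym × Move) → Sym → Move → Prog
  writeAll g s d = act λ { (h ∷ hs) → g h ∷ Vec.map (λ _ → s , d) hs }

  -- Every work tape becomes first midⁿ end, and the first cell of the input
  -- becomes first, so that all heads can find their origin.

  setup : Prog
  setup = writeAll (λ _ → first , right) first right
        ⨾ whilst isOne M (writeAll (_, right) mid right)
        -- The first 1 of the input went into `first`, so only `n - 1` marks have been written; the
        -- separating 0 supplies the last one.
        ⨾ writeAll (_, stay) mid right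
        ⨾ writeAll (_, stay) end stay
        -- One visit to the blank behind the input turns it into a listed cell, so that later visits
        -- leave the representation of the tape unchanged.
        ⨾ whilst isBit M (inc M) ⨾ dec M
        ⨾ reset M
        ⨾ reset S ⨾ reset S′
        ⨾ reset (reg U) ⨾ reset (reg V) ⨾ reset (reg A) ⨾ reset (reg B)
        ⨾ reset (reg W) ⨾ reset (reg C) ⨾ reset (reg K) ⨾ reset (reg F)

  main : Prog
  main = setup ⨾ readBudget ⨾ search

  accepts : Heads → Bool
  accepts hs = not (isFirst (lookup hs (reg F)))

  -- Tapes described by head positions

  at : Tape 3 → ℕ → Tape 3
  at t zero    = t
  at t (suc p) = move right (at t p)

  nth : ∀ {a} {X : Set a} → X → List X → ℕ → X
  nth x []       _       = x
  nth x (y ∷ ys) zero    = y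
  nth x (y ∷ ys) (suc p) = nth x ys p

  at-suc : ∀ t p → at t (suc p) ≡ at (move right t) p
  at-suc t zero    = refl
  at-suc t (suc p) = cong (move right) (at-suc t p)

  head-at : ∀ ls a rs p → Tape.head (at (tape ls a rs) p) ≡ nth blank (a ∷ rs) p
  head-at ls a rs       zero    = refl
  head-at ls a []       (suc p) =
    trans (cong Tape.head (at-suc (tape ls a []) p)) (trans (head-at (a ∷ ls) blank [] p) (blanks p))
    where
    blanks : ∀ p → nth blank (blank ∷ []) p ≡ nth {X = Sym} blank [] p
    blanks zero    = refl
    blanks (suc p) = refl
  head-at ls a (r ∷ rs) (suc p) =
    trans (cong Tape.head (at-suc (tape ls a (r ∷ rs)) p)) (head-at (a ∷ ls) r rs p)

  left-at : ∀ t p → p < length (Tape.after t) → move left (at t (suc p)) ≡ at t p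
  left-at (tape ls a (r ∷ rs)) zero    _       = refl
  left-at (tape ls a (r ∷ rs)) (suc p) (s≤s l) =
    trans (cong (move left) (at-suc (tape ls a (r ∷ rs)) (suc p)))
          (trans (left-at (tape (a ∷ ls) r rs) p l) (sym (at-suc (tape ls a (r ∷ rs)) p)))

  -- Stepping beyond the last listed cell creates an explicit blank, which remains when the head
  -- turns back. This is the origin of the trailing blank in `tape₀`.
  left-at-end : ∀ ls a rs →
    move left (at (tape ls a rs) (suc (length rs))) ≡ at (tape ls a (rs ++ blank ∷ [])) (length rs)
  left-at-end ls a []       = refl
  left-at-end ls a (r ∷ rs) =
    trans (cong (move left) (at-suc (tape ls a (r ∷ rs)) (suc (length rs))))
          (trans (left-at-end (a ∷ ls) r rs) (sym (at-suc (tape ls a (r ∷ rs ++ blank ∷ [])) (length rs))))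

  replicate-shift : ∀ {X : Set} n (x : X) xs → List.replicate n x ++ x ∷ xs ≡ x ∷ List.replicate n x ++ xs
  replicate-shift zero    x xs = refl
  replicate-shift (suc n) x xs = cong (x ∷_) (replicate-shift n x xs)

  -- `setup` leaves a tape listed outward from the end mark, while `tape₊` is listed from its
  -- origin; the two are identified here.
  at-last : ∀ ls a b e n → at (tape ls a (List.replicate n b ++ e ∷ [])) (suc n)
                         ≡ tape (List.replicate n b ++ a ∷ ls) e []
  at-last ls a b e zero    = refl
  at-last ls a b e (suc n) =
    trans (at-suc (tape ls a (b ∷ List.replicate n b ++ e ∷ [])) (suc n))
          (trans (at-last (a ∷ ls) b b e n) (cong (λ zs → tape zs e []) (replicate-shift n b (a ∷ ls))))

  module _ {L : ℕ} where

    iterate : ∀ c p (f : ℕ → Tapes) m →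
              (∀ i → i < m → c (heads (f i)) ≡ true) → c (heads (f m)) ≡ false →
              (∀ i → i < m → Exec L p (f i) (f (suc i))) → Loop L c p m (f 0) (f m)
    iterate c p f zero    go halt body = stop halt
    iterate c p f (suc m) go halt body =
      again (go 0 z<s) (body 0 z<s)
            (iterate c p (f ∘ suc) m (λ i l → go (suc i) (s≤s l)) halt (λ i l → body (suc i) (s≤s l)))

  perform-shift : ∀ {n} j d (ts : Vec (Tape 3) n) →
    perform (updateAt (idle (heads ts)) j (map₂ (const d))) ts ≡ updateAt ts j (move d)
  perform-shift zero    d (t ∷ ts) = cong (move d t ∷_) (perform-idle ts)
  perform-shift (suc j) d (t ∷ ts) = cong (t ∷_) (perform-shift j d ts)

  updateAt-zipWith : ∀ {X Y Z : Set} {n} (h : X → Y → Z) j {f g} (xs : Vec X n) (ys : Vec Y n) →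
    g (h (lookup xs j) (lookup ys j)) ≡ h (lookup xs j) (f (lookup ys j)) →
    updateAt (Vec.zipWith h xs ys) j g ≡ Vec.zipWith h xs (updateAt ys j f)
  updateAt-zipWith h zero    (x ∷ xs) (y ∷ ys) eq = cong (_∷ _) eq
  updateAt-zipWith h (suc j) (x ∷ xs) (y ∷ ys) eq = cong (_ ∷_) (updateAt-zipWith h j xs ys eq)

  total : ℕ → (ℕ → ℕ) → ℕ
  total zero    m = 0
  total (suc k) m = m (suc k) + total k m

  sgn : ℕ → ℕ
  sgn zero    = 0
  sgn (suc _) = 1

  ≢⇒≡ᵇ-false : ∀ {x y} → x ≢ y → (x ≡ᵇ y) ≡ false
  ≢⇒≡ᵇ-false {x} {y} x≢y with x ≡ᵇ y in eq
  ... | true  = contradiction (≡ᵇ⇒≡ x y (subst Bool.T (sym eq) _)) x≢y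
  ... | false = refl

  ≡ᵇ-refl : ∀ x → (x ≡ᵇ x) ≡ true
  ≡ᵇ-refl zero    = refl
  ≡ᵇ-refl (suc x) = ≡ᵇ-refl x

  -- Effect of the program on the registers

  module Semantics
    (n : ℕ) (bits digits : List Bit) (adj : ℕ → ℕ → Bool)
    (n≢0    : 0 < n)
    (size   : length bits ≡ n * suc n + length digits)
    (ones   : ∀ i → suc i < n → nth {X = Sym} blank (List.map bit bits) i ≡ bit 1b)
    (sep    : nth {X = Sym} blank (first ∷ List.map bit bits) n ≡ bit 0b)
    (matrix : ∀ x y → 0 < x → x ≤ n → 0 < y → y ≤ n →
              isOne (nth blank (first ∷ List.map bit bits) (n * x + y)) ≡ adj x y)
    (suffix : ∀ i → nth {X = Sym} blank (List.map bit bits) (n * suc n + i) ≡ nth {X = Sym} blank (List.map bit digits) i)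
    where

    cells : List Sym
    cells = List.map bit bits

    -- The length of the whole input: `bits` lacks the first symbol, which `setup` overwrites.
    L : ℕ
    L = suc (length bits)

    n<L : n < L
    n<L = s≤s (≤-trans (m≤m*n n (suc n)) (≤-trans (m≤m+n _ _) (≤-reflexive (sym size))))

    tape₀ tape₊ : Tape 3
    tape₀ = tape [] first (cells ++ blank ∷ [])
    tape₊ = tape [] first (List.replicate n mid ++ end ∷ [])

    tapeOf : Fin 11 → Tape 3
    tapeOf zero    = tape₀
    tapeOf (suc _) = tape₊

    conf : Vec ℕ 11 → Tapes
    conf = Vec.zipWith at (Vec.tabulate tapeOf)

    symbol : Fin 11 → ℕ → Sym
    symbol j p = Tape.head (at (tapeOf j) p)

    lookup-heads : ∀ j xs → lookup (heads (conf xs)) j ≡ symbol j (lookup xs j)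
    lookup-heads j xs = begin
      lookup (heads (conf xs)) j                           ≡⟨ lookup-map j Tape.head (conf xs) ⟩
      Tape.head (lookup (conf xs) j)                       ≡⟨ cong Tape.head (lookup-zipWith at j (Vec.tabulate tapeOf) xs) ⟩
      Tape.head (at (lookup (Vec.tabulate tapeOf) j) (lookup xs j))
        ≡⟨ cong (λ t → Tape.head (at t (lookup xs j))) (lookup∘tabulate tapeOf j) ⟩
      symbol j (lookup xs j)                               ∎
      where open ≡-Reasoning

    symbol₀ : ∀ p → symbol M p ≡ nth blank (first ∷ cells) p
    symbol₀ p = trans (head-at [] first (cells ++ blank ∷ []) p) (trailing (first ∷ cells) p)
      where
      trailing : ∀ cs p → nth blank (cs ++ blank ∷ []) p ≡ nth {X = Sym} blank cs p
      trailing []       zero    = refl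
      trailing []       (suc p) = refl
      trailing (c ∷ cs) zero    = refl
      trailing (c ∷ cs) (suc p) = trailing cs p

    symbol₊ : ∀ j p → symbol (suc j) p ≡ nth blank (first ∷ List.replicate n mid ++ end ∷ []) p
    symbol₊ j p = head-at [] first _ p

    notFirst : ∀ j p → not (isFirst (symbol j (suc p))) ≡ true
    notFirst zero p = trans (cong (not ∘ isFirst) (symbol₀ (suc p))) (bits≢first bits p)
      where
      bits≢first : ∀ bs p → not (isFirst (nth blank (List.map bit bs) p)) ≡ true
      bits≢first []       p       = refl
      bits≢first (b ∷ bs) zero    = refl
      bits≢first (b ∷ bs) (suc p) = bits≢first bs p
    notFirst (suc j) p = trans (cong (not ∘ isFirst) (symbol₊ j (suc p))) (marks≢first n p)
      where
      marks≢first : ∀ n p → not (isFirst (nth blank (List.replicate n mid ++ end ∷ []) p)) ≡ true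
      marks≢first zero    zero    = refl
      marks≢first zero    (suc p) = refl
      marks≢first (suc n) zero    = refl
      marks≢first (suc n) (suc p) = marks≢first n p

    isFirst-0 : ∀ j → isFirst (symbol j 0) ≡ true
    isFirst-0 zero    = refl
    isFirst-0 (suc j) = refl

    isEnd-≤ : ∀ j p → p ≤ n → isEnd (symbol (suc j) p) ≡ false
    isEnd-≤ j zero    _   = refl
    isEnd-≤ j (suc p) p<n = trans (cong isEnd (symbol₊ j (suc p))) (inner n p p<n)
      where
      inner : ∀ n p → p < n → isEnd (nth blank (List.replicate n mid ++ end ∷ []) p) ≡ false
      inner (suc n) zero    _       = refl
      inner (suc n) (suc p) (s≤s l) = inner n p l

    isEnd-last : ∀ j → isEnd (symbol (suc j) (suc n)) ≡ true
    isEnd-last j = trans (cong isEnd (symbol₊ j (suc n))) (last n)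
      where
      last : ∀ n → isEnd (nth blank (List.replicate n mid ++ end ∷ []) n) ≡ true
      last zero    = refl
      last (suc n) = last n

    -- The position of the last listed cell of each tape; up to there a left move exactly undoes a
    -- right move.
    limit : Fin 11 → ℕ
    limit zero    = L
    limit (suc _) = suc n

    limit≤L : ∀ j → limit j ≤ L
    limit≤L zero    = ≤-refl
    limit≤L (suc j) = n<L

    left-conf : ∀ j p → p < limit j → move left (at (tapeOf j) (suc p)) ≡ at (tapeOf j) p
    left-conf zero p l = left-at tape₀ p (≤-trans l (≤-reflexive (sym (begin
      length (cells ++ blank ∷ [])   ≡⟨ length-++ cells ⟩
      length cells + 1               ≡⟨ cong (_+ 1) (length-map bit bits) ⟩
      length bits + 1                ≡⟨ +-comm (length bits) 1 ⟩
      L                              ∎))))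
      where open ≡-Reasoning
    left-conf (suc j) p l = left-at tape₊ p (≤-trans l (≤-reflexive (sym (begin
      length (List.replicate n mid ++ end ∷ [])   ≡⟨ length-++ (List.replicate n mid) ⟩
      length (List.replicate n mid) + 1           ≡⟨ cong (_+ 1) (length-replicate n) ⟩
      n + 1                                       ≡⟨ +-comm n 1 ⟩
      suc n                                       ∎))))
      where open ≡-Reasoning

    infix 3 _∶_⟶_

    record _∶_⟶_ (p : Prog) (xs ys : Vec ℕ 11) : Set where
      constructor ⟨_⟩
      field exec : Exec L p (conf xs) (conf ys)

    open _∶_⟶_

    infixr 5 _⨟_

    _⨟_ : ∀ {p q xs ys zs} → p ∶ xs ⟶ ys → q ∶ ys ⟶ zs → p ⨾ q ∶ xs ⟶ zs
    ⟨ e ⟩ ⨟ ⟨ f ⟩ = ⟨ e ⨾ f ⟩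

    regroup : ∀ {p q r xs ys zs} → p ⨾ q ∶ xs ⟶ ys → r ∶ ys ⟶ zs → p ⨾ q ⨾ r ∶ xs ⟶ zs
    regroup ⟨ e ⨾ f ⟩ ⟨ g ⟩ = ⟨ e ⨾ f ⨾ g ⟩

    skips : ∀ {xs} → skip ∶ xs ⟶ xs
    skips {xs} = ⟨ subst (Exec L skip (conf xs)) (perform-idle (conf xs)) act ⟩

    shifts : ∀ j d {xs} f →
             move d (at (tapeOf j) (lookup xs j)) ≡ at (tapeOf j) (f (lookup xs j)) →
             shift j d ∶ xs ⟶ updateAt xs j f
    shifts j d {xs} f eq = ⟨ subst (Exec L (shift j d) (conf xs)) moved act ⟩
      where
      moved : perform (updateAt (idle (heads (conf xs))) j (map₂ (const d))) (conf xs) ≡ conf (updateAt xs j f)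
      moved = trans (perform-shift j d (conf xs))
                    (updateAt-zipWith at j (Vec.tabulate tapeOf) xs
                      (subst (λ t → move d (at t (lookup xs j)) ≡ at t (f (lookup xs j)))
                             (sym (lookup∘tabulate tapeOf j)) eq))

    incs : ∀ j {xs} → inc j ∶ xs ⟶ updateAt xs j suc
    incs j {xs} = shifts j right suc refl

    decs : ∀ j {xs} p → lookup xs j ≡ suc p → p < limit j → dec j ∶ xs ⟶ updateAt xs j pred
    decs j {xs} p eq l = shifts j left pred (subst (λ q → move left (at (tapeOf j) q) ≡ at (tapeOf j) (pred q))
                                            (sym eq) (left-conf j p l))

    chooses : ∀ c j {p q xs ys} b → c (symbol j (lookup xs j)) ≡ b →
              (if b then p else q) ∶ xs ⟶ ys → when c j p q ∶ xs ⟶ ys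
    chooses c j {p} {q} {xs} {ys} b eq ⟨ e ⟩ =
      ⟨ branch (subst (λ b → Exec L (if b then p else q) (conf xs) (conf ys))
                      (sym (trans (cong c (lookup-heads j xs)) eq)) e) ⟩

    whilsts : ∀ c j {p} m (f : ℕ → Vec ℕ 11) → m ≤ L →
              (∀ i → i < m → c (symbol j (lookup (f i) j)) ≡ true) →
              c (symbol j (lookup (f m) j)) ≡ false →
              (∀ i → i < m → p ∶ f i ⟶ f (suc i)) →
              whilst c j p ∶ f 0 ⟶ f m
    whilsts c j {p} m f m≤L go halt body =
      ⟨ while (iterate _ p (conf ∘ f) m
                 (λ i l → trans (cong c (lookup-heads j (f i))) (go i l))
                 (trans (cong c (lookup-heads j (f m))) halt)
                 (λ i l → exec (body i l)))
              m≤L ⟩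

    ∸-suc : ∀ {i k} → i < k → k ∸ i ≡ suc (k ∸ suc i)
    ∸-suc {i} {k} i<k = +-∸-assoc 1 i<k

    notFirst-> : ∀ j {x} → 0 < x → not (isFirst (symbol j x)) ≡ true
    notFirst-> j {suc x} _ = notFirst j x

    resets : ∀ j {xs} → lookup xs j ≤ limit j → reset j ∶ xs ⟶ xs [ j ]≔ 0
    resets j {xs} l = subst₂ (reset j ∶_⟶_) at-start at-end
      (whilsts (not ∘ isFirst) j k f (≤-trans l (limit≤L j))
        (λ i i<k → trans (cong (not ∘ isFirst ∘ symbol j) (lookup∘updateAt j xs))
                         (notFirst-> j (m<n⇒0<n∸m i<k)))
        (trans (cong (not ∘ isFirst ∘ symbol j) (trans (lookup∘updateAt j xs) (n∸n≡0 k)))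
               (cong not (isFirst-0 j)))
        λ i i<k → subst (dec j ∶ f i ⟶_) (advance i)
          (decs j (k ∸ suc i) (trans (lookup∘updateAt j xs) (∸-suc i<k))
                (≤-trans (≤-reflexive (sym (∸-suc i<k))) (≤-trans (m∸n≤m k i) l))))
      where
      k = lookup xs j
      f : ℕ → Vec ℕ 11
      f i = xs [ j ]≔ (k ∸ i)
      at-start : f 0 ≡ xs
      at-start = []≔-lookup xs j
      at-end : f k ≡ xs [ j ]≔ 0
      at-end = cong (xs [ j ]≔_) (n∸n≡0 k)
      advance : ∀ i → updateAt (f i) j pred ≡ f (suc i)
      advance i = trans (updateAt-updateAt-local j xs refl) (cong (xs [ j ]≔_) (pred[m∸n]≡m∸[1+n] k i))

    spends : ∀ j {xs} → lookup xs j ≤ limit j →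
             when isFirst j skip (dec j) ∶ xs ⟶ updateAt xs j pred
    spends j {xs} l with lookup xs j in eq
    ... | zero  = subst (when isFirst j skip (dec j) ∶ xs ⟶_)
                        (sym (updateAt-id-local j xs (trans (cong pred eq) (sym eq))))
                        (chooses isFirst j true (trans (cong (isFirst ∘ symbol j) eq) (isFirst-0 j)) skips)
    ... | suc p = chooses isFirst j false (trans (cong (isFirst ∘ symbol j) eq) (not-injective (notFirst j p)))
                          (decs j p eq l)

    rows : ∀ {x s R} → row ∶ x ∷ s ∷ 0 ∷ R ⟶ n + x ∷ s ∷ 0 ∷ R
    rows {x} {s} {R} =
        incs S′
      ⨟ whilsts (not ∘ isEnd) S′ n (λ i → i + x ∷ s ∷ suc i ∷ R) (<⇒≤ n<L)
          (λ i i<n → cong not (isEnd-≤ 1F (suc i) i<n))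
          (cong not (isEnd-last 1F))
          (λ i i<n → incs M ⨟ incs S′)
      ⨟ resets S′ ≤-refl

    -- The families `x`, `t`, `R` describe the contents after `z` rounds in all. In round `j` of the
    -- first loop `S` and `reg i` share `k` between them, hence the demand that the body works for
    -- every `s` and `y`.
    timess : ∀ i {p} k (x t : ℕ → ℕ) (R : ℕ → Vec ℕ 8) → k ≤ suc n → (∀ z → lookup (R z) i ≡ k) →
             (∀ z s y → p ∶ x z ∷ s ∷ t z ∷ R z [ i ]≔ y
                          ⟶ x (suc z) ∷ s ∷ t (suc z) ∷ R (suc z) [ i ]≔ y) →
             ∀ z → times i p ∶ x z ∷ 0 ∷ t z ∷ R z ⟶ x (k + z) ∷ 0 ∷ t (k + z) ∷ R (k + z)
    timess i {p} k x t R k≤ found body z = subst₂ (times i p ∶_⟶_) at-start at-end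
      (whilsts (not ∘ isFirst) (reg i) k down (≤-trans k≤ n<L)
          (λ j j<k → trans (cong (not ∘ isFirst ∘ symbol (reg i)) (lookup∘updateAt i (R (j + z))))
                           (notFirst-> (reg i) (m<n⇒0<n∸m j<k)))
          (trans (cong (not ∘ isFirst ∘ symbol (reg i)) (trans (lookup∘updateAt i (R (k + z))) (n∸n≡0 k)))
                 (cong not (isFirst-0 (reg i))))
          (λ j j<k →
              subst (λ R′ → dec (reg i) ∶ down j ⟶ x (j + z) ∷ j ∷ t (j + z) ∷ R′)
                (trans (updateAt-updateAt-local i (R (j + z)) refl)
                       (cong (R (j + z) [ i ]≔_) (pred[m∸n]≡m∸[1+n] k j)))
                (decs (reg i) (k ∸ suc j) (trans (lookup∘updateAt i (R (j + z))) (∸-suc j<k))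
                  (≤-trans (≤-reflexive (sym (∸-suc j<k))) (≤-trans (m∸n≤m k j) k≤)))
            ⨟ incs S
            ⨟ body (j + z) (suc j) (k ∸ suc j))
      ⨟ subst (λ o → whilst (not ∘ isFirst) S (dec S ⨾ inc (reg i)) ∶ x (k + z) ∷ k ∷ t (k + z) ∷ R (k + z) [ i ]≔ o ⟶ up k)
          (sym (n∸n≡0 k))
          (whilsts (not ∘ isFirst) S k up (≤-trans k≤ n<L)
            (λ j j<k → notFirst-> S (m<n⇒0<n∸m j<k))
            (cong (not ∘ isFirst ∘ symbol S) (n∸n≡0 k))
            (λ j j<k →
                subst (λ s → dec S ∶ up j ⟶ x (k + z) ∷ s ∷ t (k + z) ∷ R (k + z) [ i ]≔ j)
                  (pred[m∸n]≡m∸[1+n] k j)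
                  (decs S (k ∸ suc j) (∸-suc j<k)
                    (≤-trans (≤-reflexive (sym (∸-suc j<k))) (≤-trans (m∸n≤m k j) k≤)))
              ⨟ subst (λ R′ → inc (reg i) ∶ x (k + z) ∷ k ∸ suc j ∷ t (k + z) ∷ R (k + z) [ i ]≔ j
                                 ⟶ x (k + z) ∷ k ∸ suc j ∷ t (k + z) ∷ R′)
                  (updateAt-updateAt i (R (k + z)))
                  (incs (reg i)))))
      where
      down up : ℕ → Vec ℕ 11
      down j = x (j + z) ∷ j ∷ t (j + z) ∷ R (j + z) [ i ]≔ (k ∸ j)
      up   j = x (k + z) ∷ k ∸ j ∷ t (k + z) ∷ R (k + z) [ i ]≔ j
      same : ∀ z → R z [ i ]≔ k ≡ R z
      same z = trans (cong (R z [ i ]≔_) (sym (found z))) ([]≔-lookup (R z) i)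
      at-start : down 0 ≡ x z ∷ 0 ∷ t z ∷ R z
      at-start = cong (λ R′ → x z ∷ 0 ∷ t z ∷ R′) (same z)
      at-end : up k ≡ x (k + z) ∷ 0 ∷ t (k + z) ∷ R (k + z)
      at-end = cong₂ (λ s R′ → x (k + z) ∷ s ∷ t (k + z) ∷ R′) (n∸n≡0 k) (same (k + z))

    gotos : ∀ i j {R x y} → lookup R i ≡ x → lookup R j ≡ y → x ≤ suc n → y ≤ suc n →
            goto i j ∶ 0 ∷ 0 ∷ 0 ∷ R ⟶ n * x + y ∷ 0 ∷ 0 ∷ R
    gotos i j {R} {x} {y} i≡x j≡y x≤ y≤ =
        timess i x (_* n) (const 0) (const R) x≤ (const i≡x) (λ _ _ _ → rows) 0
      ⨟ subst (λ w → times j (inc M) ∶ (x + 0) * n ∷ 0 ∷ 0 ∷ R ⟶ w ∷ 0 ∷ 0 ∷ R) position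
          (timess j y (_+ (x + 0) * n) (const 0) (const R) y≤ (const j≡y) (λ _ _ _ → incs M) 0)
      where
      position : (y + 0) + (x + 0) * n ≡ n * x + y
      position = begin
        (y + 0) + (x + 0) * n  ≡⟨ cong₂ (λ a b → a + b * n) (+-identityʳ y) (+-identityʳ x) ⟩
        y + x * n              ≡⟨ +-comm y (x * n) ⟩
        x * n + y              ≡⟨ cong (_+ y) (*-comm x n) ⟩
        n * x + y              ∎
        where open ≡-Reasoning

    -- In a program that adds to Z, the index of the family Z is the number
    -- of events counted so far.

    Adds : Prog → (ℕ → Vec ℕ 8) → ℕ → Set
    Adds p Z m = ∀ z → p ∶ 0 ∷ 0 ∷ 0 ∷ Z z ⟶ 0 ∷ 0 ∷ 0 ∷ Z (m + z)

    ifAdjacents : ∀ i j {p Z x y m} → (∀ z → lookup (Z z) i ≡ x) → (∀ z → lookup (Z z) j ≡ y) →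
                  0 < x → x ≤ n → 0 < y → y ≤ n → Adds p Z m →
                  Adds (ifAdjacent i j p) Z (if adj x y then m else 0)
    ifAdjacents i j {p} {Z} {x} {y} {m} i≡x j≡y 0<x x≤n 0<y y≤n pZ z =
        gotos i j (i≡x z) (j≡y z) (m≤n⇒m≤1+n x≤n) (m≤n⇒m≤1+n y≤n)
      ⨟ chooses isOne M (adj x y) (trans (cong isOne (symbol₀ (n * x + y))) (matrix x y 0<x x≤n 0<y y≤n))
          (selected (adj x y))
      where
      bound : n * x + y ≤ L
      bound = begin
        n * x + y                     ≤⟨ +-mono-≤ (*-monoʳ-≤ n x≤n) y≤n ⟩
        n * n + n                     ≡⟨ +-comm (n * n) n ⟩
        n + n * n                     ≡⟨ *-suc n n ⟨
        n * suc n                     ≤⟨ m≤m+n _ _ ⟩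
        n * suc n + length digits     ≡⟨ size ⟨
        length bits                   ≤⟨ n≤1+n _ ⟩
        L                             ∎
        where open ≤-Reasoning
      selected : ∀ b → (if b then (reset M ⨾ p) else reset M) ∶ n * x + y ∷ 0 ∷ 0 ∷ Z z
                       ⟶ 0 ∷ 0 ∷ 0 ∷ Z ((if b then m else 0) + z)
      selected true  = resets M bound ⨟ pZ z
      selected false = resets M bound

    module _ (i j : Fin 8) {p q : Prog} {R : Vec ℕ 8} {ys : Vec ℕ 11} {x y : ℕ} (i≡x : lookup R i ≡ x) (j≡y : lookup R j ≡ y)
             (x≤ : x ≤ suc n) (y≤ : y ≤ suc n) where

      differences : times j (inc S′) ⨾ times i (when isFirst S′ skip (dec S′)) ∶
                    0 ∷ 0 ∷ 0 ∷ R ⟶ 0 ∷ 0 ∷ y ∸ x ∷ R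
      differences = subst (λ d → times j (inc S′) ⨾ times i (when isFirst S′ skip (dec S′)) ∶
                                 0 ∷ 0 ∷ 0 ∷ R ⟶ 0 ∷ 0 ∷ d ∷ R)
        (cong₂ _∸_ (+-identityʳ y) (+-identityʳ x))
        (  timess j y (const 0) (λ z → z) (const R) y≤ (const j≡y) (λ _ _ _ → incs S′) 0
         ⨟ timess i x (const 0) (λ z → (y + 0) ∸ z) (const R) x≤ (const i≡x)
             (λ z s v → subst (λ d → when isFirst S′ skip (dec S′) ∶ 0 ∷ s ∷ (y + 0) ∸ z ∷ R [ i ]≔ v
                                       ⟶ 0 ∷ s ∷ d ∷ R [ i ]≔ v)
                          (pred[m∸n]≡m∸[1+n] (y + 0) z)
                          (spends S′ (≤-trans (m∸n≤m (y + 0) z) (≤-trans (≤-reflexive (+-identityʳ y)) y≤))))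
             0)

      runsLess : x < y → p ∶ 0 ∷ 0 ∷ 0 ∷ R ⟶ ys → ifLess i j p q ∶ 0 ∷ 0 ∷ 0 ∷ R ⟶ ys
      runsLess x<y e = regroup differences
        (chooses isFirst S′ false (not-injective (notFirst-> S′ (m<n⇒0<n∸m x<y)))
          (resets S′ (≤-trans (m∸n≤m y x) y≤) ⨟ e))

      runsNotLess : y ≤ x → q ∶ 0 ∷ 0 ∷ 0 ∷ R ⟶ ys → ifLess i j p q ∶ 0 ∷ 0 ∷ 0 ∷ R ⟶ ys
      runsNotLess y≤x e = regroup differences
        (chooses isFirst S′ true (cong (isFirst ∘ symbol S′) (m≤n⇒m∸n≡0 y≤x))
          (subst (λ d → q ∶ 0 ∷ 0 ∷ d ∷ R ⟶ ys) (sym (m≤n⇒m∸n≡0 y≤x)) e))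

    ifDistincts : ∀ i j {p Z x y m} → (∀ z → lookup (Z z) i ≡ x) → (∀ z → lookup (Z z) j ≡ y) →
                  x ≤ n → y ≤ n → Adds p Z m →
                  Adds (ifDistinct i j p) Z (if x ≡ᵇ y then 0 else m)
    ifDistincts i j {p} {Z} {x} {y} {m} i≡x j≡y x≤n y≤n pZ z with <-cmp x y
    ... | tri< x<y x≢y _ rewrite ≢⇒≡ᵇ-false x≢y =
      runsLess i j (i≡x z) (j≡y z) (m≤n⇒m≤1+n x≤n) (m≤n⇒m≤1+n y≤n) x<y (pZ z)
    ... | tri≈ _ refl _ rewrite ≡ᵇ-refl x =
      runsNotLess i j (i≡x z) (j≡y z) (m≤n⇒m≤1+n x≤n) (m≤n⇒m≤1+n y≤n) ≤-refl
        (runsNotLess j i (j≡y z) (i≡x z) (m≤n⇒m≤1+n y≤n) (m≤n⇒m≤1+n x≤n) ≤-refl skips)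
    ... | tri> _ x≢y y<x rewrite ≢⇒≡ᵇ-false x≢y =
      runsNotLess i j (i≡x z) (j≡y z) (m≤n⇒m≤1+n x≤n) (m≤n⇒m≤1+n y≤n) (<⇒≤ y<x)
        (runsLess j i (j≡y z) (i≡x z) (m≤n⇒m≤1+n y≤n) (m≤n⇒m≤1+n x≤n) y<x (pZ z))

    -- The rounds accumulate in the index of `Z`. It is a ghost count that no register need hold;
    -- the contents may reflect it only in part. By `zeroed`, the loop variable is at its origin
    -- outside the loop.
    fors : ∀ i {p Z} (m : ℕ → ℕ) → (∀ z → Z z [ i ]≔ 0 ≡ Z z) →
           (∀ x → 0 < x → x ≤ n → Adds p (λ z → Z z [ i ]≔ x) (m x)) →
           Adds (for i p) Z (total n m)
    fors i {p} {Z} m zeroed body z =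
        subst (λ R → inc (reg i) ∶ 0 ∷ 0 ∷ 0 ∷ R ⟶ f 0) (zeroed z)
          (subst (λ R → inc (reg i) ∶ 0 ∷ 0 ∷ 0 ∷ Z z [ i ]≔ 0 ⟶ 0 ∷ 0 ∷ 0 ∷ R)
            (updateAt-updateAt i (Z z)) (incs (reg i)))
      ⨟ whilsts (not ∘ isEnd) (reg i) n f (<⇒≤ n<L)
          (λ j j<n → cong not (trans (cong (isEnd ∘ symbol (reg i)) (lookup∘updateAt i (Z (total j m + z))))
                                     (isEnd-≤ (suc (suc i)) (suc j) j<n)))
          (cong not (trans (cong (isEnd ∘ symbol (reg i)) (lookup∘updateAt i (Z (total n m + z))))
                           (isEnd-last (suc (suc i)))))
          (λ j j<n →
              subst (λ k → p ∶ f j ⟶ 0 ∷ 0 ∷ 0 ∷ Z k [ i ]≔ suc j) (sym (+-assoc (m (suc j)) (total j m) z))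
                (body (suc j) z<s j<n (total j m + z))
            ⨟ subst (λ R → inc (reg i) ∶ 0 ∷ 0 ∷ 0 ∷ Z (total (suc j) m + z) [ i ]≔ suc j ⟶ 0 ∷ 0 ∷ 0 ∷ R)
                (updateAt-updateAt i (Z (total (suc j) m + z))) (incs (reg i)))
      ⨟ subst (λ R → reset (reg i) ∶ f n ⟶ 0 ∷ 0 ∷ 0 ∷ R)
          (trans ([]≔-idempotent (Z (total n m + z)) i) (zeroed (total n m + z)))
          (resets (reg i) (≤-reflexive (lookup∘updateAt i (Z (total n m + z)))))
      where
      f : ℕ → Vec ℕ 11
      f j = 0 ∷ 0 ∷ 0 ∷ Z (total j m + z) [ i ]≔ suc j

    common cost : ℕ → ℕ → ℕ
    common u v = total n (λ w → if adj u w then (if adj w v then 1 else 0) else 0)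
    cost   u v = common u v + (if adj u v then 1 else 0)

    module _ {k : ℕ} (k≤n : k ≤ n) where

      verdict : ℕ → ℕ → ℕ
      verdict u v = if cost u v ≤ᵇ k then 1 else 0

      -- The index counts the successful quadruples, possibly more of them than a register can hold;
      -- therefore `F` shows only the sign of the count.
      withinBudgets : ∀ {u v a b} → 0 < u → u ≤ n → 0 < v → v ≤ n →
        Adds withinBudget (λ z → u ∷ v ∷ a ∷ b ∷ 0 ∷ 0 ∷ k ∷ sgn z ∷ []) (verdict u v)
      withinBudgets {u} {v} {a} {b} 0<u u≤n 0<v v≤n z =
          timess K k (const 0) (const 0) (λ c → u ∷ v ∷ a ∷ b ∷ 0 ∷ c ∷ k ∷ sgn z ∷ []) (m≤n⇒m≤1+n k≤n)
            (λ _ → refl) (λ _ _ _ → incs (reg C)) 0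
        ⨟ incs (reg C)
        ⨟ ifAdjacents U V {Z = R 0} (λ _ → refl) (λ _ → refl) 0<u u≤n 0<v v≤n (spending 0) 0
        ⨟ fors W {Z = R 0} (λ w → if adj u w then (if adj w v then 1 else 0) else 0) (λ _ → refl)
            (λ w 0<w w≤n → ifAdjacents U W {Z = R w} (λ _ → refl) (λ _ → refl) 0<u u≤n 0<w w≤n
                             (ifAdjacents W V {Z = R w} (λ _ → refl) (λ _ → refl) 0<w w≤n 0<v v≤n (spending w)))
            ((if adj u v then 1 else 0) + 0)
        ⨟ subst (λ c → final ∶ state c (sgn z) ⟶ state 0 (sgn (verdict u v + z)))
            (sym (cong₂ (λ i j → suc i ∸ (common u v + j)) (+-identityʳ k) (+-identityʳ (if adj u v then 1 else 0))))
            conclude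
        where
        state : ℕ → ℕ → Vec ℕ 11
        state c f = 0 ∷ 0 ∷ 0 ∷ u ∷ v ∷ a ∷ b ∷ 0 ∷ c ∷ k ∷ f ∷ []
        -- A second ghost count: after `c` charges, `C` holds what is left of `k + 1`, and
        -- truncation at zero stands for an exhausted budget.
        R : ℕ → ℕ → Vec ℕ 8
        R w c = u ∷ v ∷ a ∷ b ∷ w ∷ suc (k + 0) ∸ c ∷ k ∷ sgn z ∷ []
        spending : ∀ w → Adds spend (R w) 1
        spending w c = subst (λ d → spend ∶ 0 ∷ 0 ∷ 0 ∷ R w c ⟶ 0 ∷ 0 ∷ 0 ∷ u ∷ v ∷ a ∷ b ∷ w ∷ d ∷ k ∷ sgn z ∷ [])
          (pred[m∸n]≡m∸[1+n] (suc (k + 0)) c)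
          (spends (reg C) (≤-trans (m∸n≤m (suc (k + 0)) c) (s≤s (≤-trans (≤-reflexive (+-identityʳ k)) k≤n))))
        raise final : Prog
        raise = when isFirst (reg F) (inc (reg F)) skip
        final = when isFirst (reg C) skip (raise ⨾ reset (reg C))
        raises : ∀ {c} z → raise ∶ state c (sgn z) ⟶ state c 1
        raises zero    = chooses isFirst (reg F) true refl (incs (reg F))
        raises (suc z) = chooses isFirst (reg F) false (not-injective (notFirst (reg F) 0)) skips
        conclude : final ∶ state (suc k ∸ cost u v) (sgn z) ⟶ state 0 (sgn (verdict u v + z))
        conclude with cost u v ≤ᵇ k in eq
        ... | true = subst (λ c → final ∶ state c (sgn z) ⟶ state 0 1) (sym (+-∸-assoc 1 cost≤k))
              (chooses isFirst (reg C) false (not-injective (notFirst (reg C) (k ∸ cost u v)))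
                (raises z ⨟ resets (reg C) (s≤s (≤-trans (m∸n≤m k (cost u v)) k≤n))))
          where
          cost≤k : cost u v ≤ k
          cost≤k = ≤ᵇ⇒≤ _ _ (subst Bool.T (sym eq) _)
        ... | false = subst (λ c → final ∶ state c (sgn z) ⟶ state 0 (sgn z)) (sym (m≤n⇒m∸n≡0 k<cost))
              (chooses isFirst (reg C) true refl skips)
          where
          k<cost : k < cost u v
          k<cost = ≰⇒> λ l → subst Bool.T eq (≤⇒≤ᵇ l)

      findings : ℕ
      findings =
        total n λ u → total n λ v → total n λ a → total n λ b →
        if adj u a then (if adj a b then (if adj b v then
          (if u ≡ᵇ v then 0 else if u ≡ᵇ b then 0 else if a ≡ᵇ v then 0 else verdict u v)
        else 0) else 0) else 0

      searches : search ∶ 0 ∷ 0 ∷ 0 ∷ 0 ∷ 0 ∷ 0 ∷ 0 ∷ 0 ∷ 0 ∷ k ∷ 0 ∷ []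
                        ⟶ 0 ∷ 0 ∷ 0 ∷ 0 ∷ 0 ∷ 0 ∷ 0 ∷ 0 ∷ 0 ∷ k ∷ sgn findings ∷ []
      searches = subst (λ z → search ∶ 0 ∷ 0 ∷ 0 ∷ R 0 0 0 0 0 ⟶ 0 ∷ 0 ∷ 0 ∷ R 0 0 0 0 z) (+-identityʳ findings) (
        fors U {Z = R 0 0 0 0} _ (λ _ → refl) (λ u 0<u u≤n →
        fors V {Z = R u 0 0 0} _ (λ _ → refl) (λ v 0<v v≤n →
        fors A {Z = R u v 0 0} _ (λ _ → refl) (λ a 0<a a≤n →
        fors B {Z = R u v a 0} _ (λ _ → refl) (λ b 0<b b≤n →
        ifAdjacents U A {Z = R u v a b} (λ _ → refl) (λ _ → refl) 0<u u≤n 0<a a≤n (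
        ifAdjacents A B {Z = R u v a b} (λ _ → refl) (λ _ → refl) 0<a a≤n 0<b b≤n (
        ifAdjacents B V {Z = R u v a b} (λ _ → refl) (λ _ → refl) 0<b b≤n 0<v v≤n (
        ifDistincts U V {Z = R u v a b} (λ _ → refl) (λ _ → refl) u≤n v≤n (
        ifDistincts U B {Z = R u v a b} (λ _ → refl) (λ _ → refl) u≤n b≤n (
        ifDistincts A V {Z = R u v a b} (λ _ → refl) (λ _ → refl) a≤n v≤n (
        withinBudgets 0<u u≤n 0<v v≤n)))))))))) 0)
        where
        R : ℕ → ℕ → ℕ → ℕ → ℕ → Vec ℕ 8
        R u v a b z = u ∷ v ∷ a ∷ b ∷ 0 ∷ 0 ∷ k ∷ sgn z ∷ []

    -- Reading the binary budget with cut-off at `n`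

    capIncs : ∀ i {x s t R} → lookup R i ≤ n →
              capInc i ∶ x ∷ s ∷ t ∷ R ⟶ x ∷ s ∷ t ∷ updateAt R i (λ y → n ⊓ suc y)
    capIncs i {x} {s} {t} {R} l with m≤n⇒m<n∨m≡n l
    ... | inj₁ y<n = incs (reg i) ⨟ chooses isEnd (reg i) false
            (trans (cong (isEnd ∘ symbol (reg i)) (lookup∘updateAt i R)) (isEnd-≤ (suc (suc i)) _ y<n))
            (subst (λ R′ → skip ∶ x ∷ s ∷ t ∷ updateAt R i suc ⟶ x ∷ s ∷ t ∷ R′)
              (updateAt-cong-local i R (sym (m≥n⇒m⊓n≡n y<n))) skips)
    ... | inj₂ y≡n = incs (reg i) ⨟ chooses isEnd (reg i) true
            (trans (cong (isEnd ∘ symbol (reg i)) (trans (lookup∘updateAt i R) (cong suc y≡n))) (isEnd-last (suc (suc i))))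
            (subst (λ R′ → dec (reg i) ∶ x ∷ s ∷ t ∷ updateAt R i suc ⟶ x ∷ s ∷ t ∷ R′)
              (updateAt-updateAt-local i R
                (trans y≡n (sym (m≤n⇒m⊓n≡m (≤-trans (≤-reflexive (sym y≡n)) (n≤1+n _))))))
              (decs (reg i) (lookup R i) (lookup∘updateAt i R) (s≤s l)))

    -- Hence cutting off at every increment amounts to cutting off once, at the end.
    ⊓-suc-⊓ : ∀ y → n ⊓ suc (n ⊓ y) ≡ n ⊓ suc y
    ⊓-suc-⊓ y with ≤-total n y
    ... | inj₁ n≤y = trans (cong (λ z → n ⊓ suc z) (m≤n⇒m⊓n≡m n≤y))
                           (trans (m≤n⇒m⊓n≡m (n≤1+n n)) (sym (m≤n⇒m⊓n≡m (m≤n⇒m≤1+n n≤y))))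
    ... | inj₂ y≤n = cong (λ z → n ⊓ suc z) (m≥n⇒m⊓n≡n y≤n)

    -- Twice the weight, cut off at `n`. The summand 0 is the start index of `timess`, here and in
    -- `accumulate`.
    weigh : ℕ → ℕ
    weigh w = n ⊓ (w + 0 + w)

    accumulate : Sym → ℕ → ℕ → ℕ
    accumulate d w k = if isOne d then n ⊓ (w + 0 + k) else k

    addDigits : ∀ {p w k} → w ≤ n → k ≤ n →
      addDigit ∶ p ∷ 0 ∷ 0 ∷ suc n ∷ 1 ∷ 0 ∷ 0 ∷ w ∷ 0 ∷ k ∷ 0 ∷ []
             ⟶ suc p ∷ 0 ∷ 0 ∷ suc n ∷ 1 ∷ 0 ∷ 0 ∷ weigh w ∷ 0 ∷ accumulate (symbol M p) w k ∷ 0 ∷ []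
    addDigits {p} {w} {k} w≤n k≤n =
        chooses isOne M (isOne (symbol M p)) refl (selected (isOne (symbol M p)))
      ⨟ timess W w (const p) (λ z → z) (λ _ → regs w k′) (m≤n⇒m≤1+n w≤n) (λ _ → refl) (λ _ _ _ → incs S′) 0
      ⨟ subst₂ (whilst (not ∘ isFirst) S′ (dec S′ ⨾ capInc W) ∶_⟶_)
          (cong (λ v → p ∷ 0 ∷ w + 0 ∷ regs v k′) (m≥n⇒m⊓n≡n w≤n))
          (cong (λ t → p ∷ 0 ∷ t ∷ regs (weigh w) k′) (n∸n≡0 (w + 0)))
          (whilsts (not ∘ isFirst) S′ (w + 0) f (≤-trans (≤-trans w+0≤n (n≤1+n n)) n<L)
            (λ i i<w → notFirst-> S′ (m<n⇒0<n∸m i<w))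
            (cong (not ∘ isFirst ∘ symbol S′) (n∸n≡0 (w + 0)))
            (λ i i<w →
                subst (λ t → dec S′ ∶ f i ⟶ p ∷ 0 ∷ t ∷ regs (n ⊓ (i + w)) k′)
                  (pred[m∸n]≡m∸[1+n] (w + 0) i)
                  (decs S′ (w + 0 ∸ suc i) (∸-suc i<w)
                    (≤-trans (≤-reflexive (sym (∸-suc i<w))) (≤-trans (m∸n≤m (w + 0) i) (m≤n⇒m≤1+n w+0≤n))))
              ⨟ subst (λ v → capInc W ∶ p ∷ 0 ∷ w + 0 ∸ suc i ∷ regs (n ⊓ (i + w)) k′
                                      ⟶ p ∷ 0 ∷ w + 0 ∸ suc i ∷ regs v k′)
                  (⊓-suc-⊓ (i + w)) (capIncs W (m⊓n≤m n (i + w)))))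
      ⨟ incs M
      where
      k′ = accumulate (symbol M p) w k
      regs : ℕ → ℕ → Vec ℕ 8
      regs w k = suc n ∷ 1 ∷ 0 ∷ 0 ∷ w ∷ 0 ∷ k ∷ 0 ∷ []
      w+0≤n : w + 0 ≤ n
      w+0≤n = ≤-trans (≤-reflexive (+-identityʳ w)) w≤n
      f : ℕ → Vec ℕ 11
      f i = p ∷ 0 ∷ w + 0 ∸ i ∷ regs (n ⊓ (i + w)) k′
      selected : ∀ b → (if b then times W (capInc K) else skip) ∶
        p ∷ 0 ∷ 0 ∷ regs w k ⟶ p ∷ 0 ∷ 0 ∷ regs w (if b then n ⊓ (w + 0 + k) else k)
      selected false = skips
      selected true  = subst (λ l → times W (capInc K) ∶ p ∷ 0 ∷ 0 ∷ regs w l ⟶ p ∷ 0 ∷ 0 ∷ regs w (n ⊓ (w + 0 + k)))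
        (m≥n⇒m⊓n≡n k≤n)
        (timess W w (const p) (const 0) (λ z → regs w (n ⊓ (z + k))) (m≤n⇒m≤1+n w≤n) (λ _ → refl)
          (λ z s y → subst (λ v → capInc K ∶ p ∷ s ∷ 0 ∷ regs y (n ⊓ (z + k)) ⟶ p ∷ s ∷ 0 ∷ regs y v)
                       (⊓-suc-⊓ (z + k)) (capIncs K (m⊓n≤m n (z + k))))
          0)

    digit : List Bit → ℕ → Sym
    digit ds = nth blank (List.map bit ds)

    weight : ℕ → ℕ → ℕ
    weight w zero    = w
    weight w (suc i) = weigh (weight w i)

    value : List Bit → ℕ → ℕ → ℕ → ℕ
    value ds w k zero    = k
    value ds w k (suc i) = accumulate (digit ds i) (weight w i) (value ds w k i)

    weight≤ : ∀ {w} i → w ≤ n → weight w i ≤ n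
    weight≤ zero    w≤n = w≤n
    weight≤ (suc i) w≤n = m⊓n≤m n _

    accumulate≤ : ∀ d w {k} → k ≤ n → accumulate d w k ≤ n
    accumulate≤ d w k≤n with isOne d
    ... | true  = m⊓n≤m n _
    ... | false = k≤n

    value≤ : ∀ ds w {k} i → k ≤ n → value ds w k i ≤ n
    value≤ ds w zero    k≤n = k≤n
    value≤ ds w (suc i) k≤n = accumulate≤ (digit ds i) (weight w i) (value≤ ds w i k≤n)

    weight-shift : ∀ w i → weight w (suc i) ≡ weight (weigh w) i
    weight-shift w zero    = refl
    weight-shift w (suc i) = cong weigh (weight-shift w i)

    -- `value` follows the loop and splits off the last digit read, whereas `fromDigits` splits off
    -- the first; this changes from one recursion to the other.
    value-shift : ∀ d ds w k i →
      value (d ∷ ds) w k (suc i) ≡ value ds (weigh w) (accumulate (bit d) w k) i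
    value-shift d ds w k zero    = refl
    value-shift d ds w k (suc i) = cong₂ (accumulate (digit ds i)) (weight-shift w i) (value-shift d ds w k i)

    -- As soon as `a` or `b` reaches `n`, both sides are `n`, except that `b` does not count when
    -- `c` is zero.
    ⊓-absorb : ∀ a b c → n ⊓ (n ⊓ a + n ⊓ b * c) ≡ n ⊓ (a + b * c)
    ⊓-absorb a b c with ≤-total n a
    ... | inj₁ n≤a rewrite m≤n⇒m⊓n≡m n≤a =
      trans (m≤n⇒m⊓n≡m (m≤m+n n _)) (sym (m≤n⇒m⊓n≡m (≤-trans n≤a (m≤m+n a _))))
    ⊓-absorb a b c | inj₂ a≤n rewrite m≥n⇒m⊓n≡n a≤n with ≤-total b n
    ... | inj₁ b≤n rewrite m≥n⇒m⊓n≡n b≤n = refl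
    ⊓-absorb a b zero    | inj₂ a≤n | inj₂ n≤b rewrite *-zeroʳ (n ⊓ b) | *-zeroʳ b = refl
    ⊓-absorb a b (suc c) | inj₂ a≤n | inj₂ n≤b rewrite m≤n⇒m⊓n≡m n≤b =
      trans (m≤n⇒m⊓n≡m (≤-trans (m≤m*n n (suc c)) (m≤n+m _ a)))
            (sym (m≤n⇒m⊓n≡m (≤-trans n≤b (≤-trans (m≤m*n b (suc c)) (m≤n+m _ a)))))

    -- Generalised over the weight and the sum so far, because each digit adds a multiple of `w` to
    -- `k` and doubles `w`; `⊓-absorb` removes the inner cut-offs.
    value-digits : ∀ ds w k → k ≤ n → value ds w k (length ds) ≡ n ⊓ (k + w * fromDigits ds)
    value-digits [] w k k≤n =
      sym (trans (cong (n ⊓_) (trans (cong (k +_) (*-zeroʳ w)) (+-identityʳ k))) (m≥n⇒m⊓n≡n k≤n))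
    value-digits (d ∷ ds) w k k≤n = begin
      value (d ∷ ds) w k (suc (length ds))               ≡⟨ value-shift d ds w k (length ds) ⟩
      value ds (weigh w) k′ (length ds)
        ≡⟨ value-digits ds (weigh w) k′ (accumulate≤ (bit d) w k≤n) ⟩
      n ⊓ (k′ + weigh w * D)                            ≡⟨ cong (λ a → n ⊓ (a + weigh w * D)) (summand d) ⟩
      n ⊓ (n ⊓ (w * toℕ d + k) + weigh w * D)           ≡⟨ ⊓-absorb (w * toℕ d + k) (w + 0 + w) D ⟩
      n ⊓ (w * toℕ d + k + (w + 0 + w) * D)             ≡⟨ cong (n ⊓_) (rearrange w (toℕ d) k D) ⟩
      n ⊓ (k + w * (toℕ d + D * 2))                     ∎
      where
      open ≡-Reasoning
      k′ = accumulate (bit d) w k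
      D = fromDigits ds
      summand : ∀ d → accumulate (bit d) w k ≡ n ⊓ (w * toℕ d + k)
      summand 0F = sym (trans (cong (λ a → n ⊓ (a + k)) (*-zeroʳ w)) (m≥n⇒m⊓n≡n k≤n))
      summand 1F = cong (λ a → n ⊓ (a + k)) (trans (+-identityʳ w) (sym (*-identityʳ w)))
      rearrange : ∀ w e k D → w * e + k + (w + 0 + w) * D ≡ k + w * (e + D * 2)
      rearrange = solve-∀

    readBudgets : readBudget ∶ 0 ∷ 0 ∷ 0 ∷ 0 ∷ 0 ∷ 0 ∷ 0 ∷ 0 ∷ 0 ∷ 0 ∷ 0 ∷ []
                             ⟶ 0 ∷ 0 ∷ 0 ∷ 0 ∷ 0 ∷ 0 ∷ 0 ∷ 0 ∷ 0 ∷ n ⊓ fromDigits digits ∷ 0 ∷ []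
    readBudgets =
        incs (reg W) ⨟ incs (reg V) ⨟ incs (reg U)
      ⨟ whilsts (not ∘ isEnd) (reg U) n (λ i → 0 ∷ 0 ∷ 0 ∷ suc i ∷ 1 ∷ 0 ∷ 0 ∷ 1 ∷ 0 ∷ 0 ∷ 0 ∷ []) (<⇒≤ n<L)
          (λ i i<n → cong not (isEnd-≤ 2F (suc i) i<n)) (cong not (isEnd-last 2F)) (λ _ _ → incs (reg U))
      ⨟ gotos U V refl refl ≤-refl (s≤s z≤n)
      ⨟ subst (λ v → whilst isBit M addDigit ∶ f 0 ⟶ end-state v)
          (trans (value-digits digits 1 0 z≤n) (cong (n ⊓_) (*-identityˡ (fromDigits digits))))
          (whilsts isBit M (length digits) f digits≤L
            (λ i i<l → trans (cong isBit (digit-symbol i)) (isBit-digit digits i i<l))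
            (trans (cong isBit (digit-symbol (length digits))) (notBit-digit digits))
            (λ i _ → subst (λ s → addDigit ∶ f i ⟶ suc i + P ∷ 0 ∷ 0 ∷ suc n ∷ 1 ∷ 0 ∷ 0 ∷ weight 1 (suc i) ∷ 0
                                     ∷ accumulate s (weight 1 i) (value digits 1 0 i) ∷ 0 ∷ [])
                       (digit-symbol i)
                       -- The initial weight 1 respects the cap because `n` is positive.
                       (addDigits (weight≤ i n≢0) (value≤ digits 1 i z≤n))))
      ⨟ resets M (≤-reflexive total-length)
      ⨟ resets (reg U) ≤-refl ⨟ resets (reg V) (s≤s z≤n) ⨟ resets (reg W) (m≤n⇒m≤1+n (weight≤ (length digits) n≢0))
      where
      P = n * suc n + 1
      f : ℕ → Vec ℕ 11
      f i = i + P ∷ 0 ∷ 0 ∷ suc n ∷ 1 ∷ 0 ∷ 0 ∷ weight 1 i ∷ 0 ∷ value digits 1 0 i ∷ 0 ∷ []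
      end-state : ℕ → Vec ℕ 11
      end-state v = length digits + P ∷ 0 ∷ 0 ∷ suc n ∷ 1 ∷ 0 ∷ 0 ∷ weight 1 (length digits) ∷ 0 ∷ v ∷ 0 ∷ []
      position : ∀ i → i + P ≡ suc (n * suc n + i)
      position i = begin
        i + (n * suc n + 1)      ≡⟨ +-comm i (n * suc n + 1) ⟩
        n * suc n + 1 + i        ≡⟨ +-assoc (n * suc n) 1 i ⟩
        n * suc n + suc i        ≡⟨ +-suc (n * suc n) i ⟩
        suc (n * suc n + i)      ∎
        where open ≡-Reasoning
      total-length : length digits + P ≡ L
      total-length = trans (position (length digits)) (cong suc (sym size))
      digits≤L : length digits ≤ L
      digits≤L = ≤-trans (m≤m+n (length digits) P) (≤-reflexive total-length)
      digit-symbol : ∀ i → symbol M (i + P) ≡ digit digits i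
      digit-symbol i = trans (cong (symbol M) (position i)) (trans (symbol₀ (suc (n * suc n + i))) (suffix i))
      isBit-digit : ∀ ds i → i < length ds → isBit (digit ds i) ≡ true
      isBit-digit (d ∷ ds) zero    _       = refl
      isBit-digit (d ∷ ds) (suc i) (s≤s l) = isBit-digit ds i l
      notBit-digit : ∀ ds → isBit (digit ds (length ds)) ≡ false
      notBit-digit []       = refl
      notBit-digit (d ∷ ds) = notBit-digit ds

    -- Preparation of the tapes and the complete run

    nth-bits : ∀ bs i → i < length bs → isBit (nth blank (List.map bit bs) i) ≡ true
    nth-bits (b ∷ bs) zero    _       = refl
    nth-bits (b ∷ bs) (suc i) (s≤s l) = nth-bits bs i l

    nth-blank : ∀ bs → isBit (nth blank (List.map bit bs) (length bs)) ≡ false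
    nth-blank []       = refl
    nth-blank (b ∷ bs) = nth-blank bs

    input : Tapes
    input = inputTape (1b ∷ bits) ∷ Vec.replicate 10 blankTape

    setups : Exec L setup input (conf (Vec.replicate 11 0))
    setups =
      act
      ⨾ subst (Exec L (whilst isOne M (writeAll (_, right) mid right)) _) (cong marked suc-m)
          (while (iterate _ _ (λ i → marking (suc i) i) m
                   (λ i i<m → trans (cong isOne (head-raw (suc i)))
                                    (cong isOne (ones i (≤-trans (s≤s i<m) (≤-reflexive suc-m)))))
                   (trans (cong isOne (head-raw (suc m)))
                          (cong isOne (subst (λ k → nth blank (first ∷ cells) k ≡ bit 0b) (sym suc-m) sep)))
                   (λ i i<m → act))
                 (≤-trans (n≤1+n m) (≤-trans (≤-reflexive suc-m) (<⇒≤ n<L))))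
      ⨾ subst (λ k → Exec L (writeAll (_, stay) mid right) (marked n)
                       (at raw n ∷ Vec.replicate 10 (tape (List.replicate k mid ++ first ∷ []) blank [])))
          suc-m act
      ⨾ act
      ⨾ while (iterate _ _ (λ i → scanning (i + n)) (L ∸ n)
                 (λ i i<d → trans (cong isBit (head-raw (i + n))) (inside (i + n) (≤-trans n≢0 (m≤n+m n i))
                              (≤-trans (+-monoˡ-< n i<d) (≤-reflexive d+n))))
                 (trans (cong isBit (trans (head-raw (L ∸ n + n)) (cong (nth blank (first ∷ cells)) d+n))) (nth-blank bits))
                 (λ i _ → act))
              (m∸n≤m L n)
      ⨾ subst₂ (Exec L (dec M)) (cong scanning (sym d+n)) arrived act
      ⨾ exec (resets M {length bits ∷ Vec.replicate 10 (suc n)} (n≤1+n _)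
             ⨟ resets S ≤-refl ⨟ resets S′ ≤-refl
             ⨟ resets (reg U) ≤-refl ⨟ resets (reg V) ≤-refl ⨟ resets (reg A) ≤-refl ⨟ resets (reg B) ≤-refl
             ⨟ resets (reg W) ≤-refl ⨟ resets (reg C) ≤-refl ⨟ resets (reg K) ≤-refl ⨟ resets (reg F) ≤-refl)
      where
      raw = tape [] first cells
      m = pred n
      suc-m : suc m ≡ n
      suc-m = suc-pred n {{>-nonZero n≢0}}
      marking : ℕ → ℕ → Tapes
      marking p i = at raw p ∷ Vec.replicate 10 (tape (List.replicate i mid ++ first ∷ []) blank [])
      marked : ℕ → Tapes
      marked k = at raw k ∷ Vec.replicate 10 (tape (List.replicate m mid ++ first ∷ []) blank [])
      scanning : ℕ → Tapes
      scanning p = at raw p ∷ Vec.replicate 10 (tape (List.replicate n mid ++ first ∷ []) end [])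
      head-raw : ∀ p → Tape.head (at raw p) ≡ nth blank (first ∷ cells) p
      head-raw = head-at [] first cells
      d+n : L ∸ n + n ≡ L
      d+n = m∸n+n≡m (<⇒≤ n<L)
      inside : ∀ p → 0 < p → p < L → isBit (nth blank (first ∷ cells) p) ≡ true
      inside (suc p) _ (s≤s l) = nth-bits bits p l
      arrived : move left (at raw L) ∷ Vec.replicate 10 (tape (List.replicate n mid ++ first ∷ []) end [])
              ≡ conf (length bits ∷ Vec.replicate 10 (suc n))
      arrived = cong₂ (λ t s → t ∷ Vec.replicate 10 s)
        (subst (λ l → move left (at raw (suc l)) ≡ at tape₀ l) (length-map bit bits) (left-at-end [] first cells))
        (sym (at-last [] first mid end n))

    executes : let k≤n = m⊓n≤m n (fromDigits digits) in
      Exec L main input (conf (0 ∷ 0 ∷ 0 ∷ 0 ∷ 0 ∷ 0 ∷ 0 ∷ 0 ∷ 0 ∷ n ⊓ fromDigits digits ∷ sgn (findings k≤n) ∷ []))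
    executes = setups ⨾ exec readBudgets ⨾
      exec (searches (m⊓n≤m n (fromDigits digits)))

    accepts-sgn : ∀ {xs} m → lookup xs (reg F) ≡ sgn m → accepts (heads (conf xs)) ≡ not (m ≡ᵇ 0)
    accepts-sgn {xs} m eq = trans (cong (not ∘ isFirst) (trans (lookup-heads (reg F) xs) (cong (symbol (reg F)) eq)))
                                  (answer m)
      where
      answer : ∀ m → not (isFirst (symbol (reg F) (sgn m))) ≡ not (m ≡ᵇ 0)
      answer zero    = refl
      answer (suc m) = notFirst (reg F) 0


-- Minima, maxima and the pigeonhole principle

least : ∀ {P : ℕ → Set} → (∀ m → Dec (P m)) → ∀ {m} → P m → ∃[ d ] P d × (∀ {i} → P i → d ≤ i)
least {P} P? {m} p = search m 0 (subst P (sym (+-identityʳ m)) p) (λ _ → z≤n)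
  where
  search : ∀ fuel b → P (fuel + b) → (∀ {i} → P i → b ≤ i) → ∃[ d ] P d × (∀ {i} → P i → d ≤ i)
  search fuel b q below with P? b
  search fuel    b q below | yes pb = b , pb , below
  search zero    b q below | no ¬pb = contradiction q ¬pb
  search (suc f) b q below | no ¬pb =
    search f (suc b) (subst P (sym (+-suc f b)) q)
      (λ r → ≤∧≢⇒< (below r) λ { refl → ¬pb r })

maximum : ∀ {n} .{{_ : NonZero n}} (f : Fin n → ℕ) → ∃[ i ] ∀ j → f j ≤ f i
maximum {suc zero}    f = zero , λ { zero → ≤-refl }
maximum {suc (suc n)} f with maximum (f ∘ suc)
... | i , f≤ with ≤-total (f zero) (f (suc i))
...   | inj₁ l = suc i , λ { zero → l ; (suc j) → f≤ j }
...   | inj₂ l = zero  , λ { zero → ≤-refl ; (suc j) → ≤-trans (f≤ j) l }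

unique-lookup : ∀ {X : Set} {xs : List X} → Unique xs → ∀ i j → List.lookup xs i ≡ List.lookup xs j → i ≡ j
unique-lookup {xs = x ∷ xs} (x∉ ∷ u) zero    zero    eq = refl
unique-lookup {xs = x ∷ xs} (x∉ ∷ u) zero    (suc j) eq = contradiction eq (All.lookup x∉ (∈-lookup j))
unique-lookup {xs = x ∷ xs} (x∉ ∷ u) (suc i) zero    eq = contradiction (sym eq) (All.lookup x∉ (∈-lookup i))
unique-lookup {xs = x ∷ xs} (x∉ ∷ u) (suc i) (suc j) eq = cong suc (unique-lookup u i j eq)

-- Pigeonhole: sending a position in `xs` to a position of the same element in `ys` is injective.
unique-length≤ : ∀ {X : Set} {xs ys : List X} → Unique xs → (∀ {x} → x ∈ xs → x ∈ ys) → length xs ≤ length ys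
unique-length≤ {X} {xs} {ys} u sub = Fin.injective⇒≤ {f = λ i → index (sub (∈-lookup {xs = xs} i))} λ {i} {j} eq →
  unique-lookup u i j (Membership.index-injective (setoid X) (sub (∈-lookup i)) (sub (∈-lookup j)) eq)

-- Distances and the diameter of a connected graph

module Distances (H : Graph) where
  open Graph H using (Adjacent)

  -- The walk is cut at an occurrence of `u`, and the remaining part inherits distinctness of its
  -- vertices.
  from-member : ∀ {u x v} (w : Walk H x v) → Unique (vertices H w) → u ∈ vertices H w →
                Σ (Path H u v) λ p → pathLength H p ≤ edgeCount H w
  from-member ε       u        (here refl) = record { walk = ε ; distinct = u } , z≤n
  from-member (e ◅ w) u        (here refl) = record { walk = e ◅ w ; distinct = u } , ≤-refl
  from-member (e ◅ w) (_ ∷ us) (there i)   with from-member w us i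
  ... | p , p≤ = p , m≤n⇒m≤1+n p≤

  -- If the start recurs on the path extracted from the rest, going on from that occurrence removes
  -- a closed walk.
  shortcut : ∀ {u v} (w : Walk H u v) → Σ (Path H u v) λ p → pathLength H p ≤ edgeCount H w
  shortcut ε = record { walk = ε ; distinct = [] ∷ [] } , z≤n
  shortcut {u} (e ◅ w) with shortcut w
  ... | p , p≤ with any? (u Fin.≟_) (vertices H (Path.walk p))
  ...   | yes i with from-member (Path.walk p) (Path.distinct p) i
  ...     | q , q≤ = q , m≤n⇒m≤1+n (≤-trans q≤ p≤)
  shortcut {u} (e ◅ w) | p , p≤ | no u∉ =
    record { walk = e ◅ Path.walk p ; distinct = All.tabulate (λ { i refl → u∉ i }) ∷ Path.distinct p } , s≤s p≤

  WalkOfLength : ℕ → Vertex H → Vertex H → Set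
  WalkOfLength m u v = Σ (Walk H u v) λ w → edgeCount H w ≡ m

  walkOfLength? : ∀ m u v → Dec (WalkOfLength m u v)
  walkOfLength? zero u v = map′ (λ { refl → ε , refl }) (λ { (ε , _) → refl }) (u Fin.≟ v)
  walkOfLength? (suc m) u v =
    map′ (λ { (x , e , w , eq) → e ◅ w , cong suc eq }) (λ { (e ◅ w , eq) → _ , e , w , suc-injective eq })
         (Fin.any? λ x → T? (has (edges H) u x) ×-dec walkOfLength? m x v)

  -- By `shortcut` the least length of a walk is attained by a path, so the search can range over
  -- walks, whose existence for a given length is decidable.
  distance : ∀ {u v} → Path H u v → ∃[ d ] IsDistance H u v d
  distance {u} {v} p with least (λ m → walkOfLength? m u v) (Path.walk p , refl)
  ... | d , (w , refl) , d≤ with shortcut w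
  ...   | q , q≤ = d , (q , ≤-antisym q≤ (d≤ (Path.walk q , refl))) , λ r → d≤ (Path.walk r , refl)

  distance-≤-walk : ∀ {u v d} → IsDistance H u v d → (w : Walk H u v) → d ≤ edgeCount H w
  distance-≤-walk (_ , d≤) w with shortcut w
  ... | p , p≤ = ≤-trans (d≤ p) p≤

  distance-≤ : ∀ {u v d d′} → IsDistance H u v d → IsDistance H u v d′ → d ≤ d′
  distance-≤ (_ , d≤) ((p , refl) , _) = d≤ p

  diameter : Connected H → ∃[ D ] IsDiameter H D
  diameter conn = dist u v , (u , v , proj₂ (distance (conn u v))) ,
    λ x y d isD → ≤-trans (distance-≤ isD (proj₂ (distance (conn x y))))
                          (≤-trans (proj₂ (farthest x) y) (proj₂ eccentric x))
    where
    instance order≢0 = Graph.order≢0 H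
    dist : Vertex H → Vertex H → ℕ
    dist x y = proj₁ (distance (conn x y))
    farthest : ∀ x → ∃[ y ] ∀ z → dist x z ≤ dist x y
    farthest x = maximum (dist x)
    eccentric : ∃[ x ] ∀ z → dist z (proj₁ (farthest z)) ≤ dist x (proj₁ (farthest x))
    eccentric = maximum (λ x → dist x (proj₁ (farthest x)))
    u = proj₁ eccentric
    v = proj₁ (farthest u)

-- Counting edges

-- For distinct vertices, the ordered pair under which their edge is counted in `∣_∣`.
normal : ∀ {n} → Fin n → Fin n → Fin n × Fin n
normal x y with x Fin.<? y
... | yes _ = x , y
... | no  _ = y , x

normal-< : ∀ {n} {x y : Fin n} → x Fin.< y → normal x y ≡ (x , y)
normal-< {x = x} {y} x<y with x Fin.<? y
... | yes _ = refl
... | no ≮ = contradiction x<y ≮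

normal-> : ∀ {n} {x y : Fin n} → x Fin.< y → normal y x ≡ (x , y)
normal-> {x = x} {y} x<y with y Fin.<? x
... | yes y<x = contradiction y<x (<-asym x<y)
... | no _ = refl

normal-injective : ∀ {n} {x y x′ y′ : Fin n} → normal x y ≡ normal x′ y′ →
                   (x ≡ x′ × y ≡ y′) ⊎ (x ≡ y′ × y ≡ x′)
normal-injective {x = x} {y} {x′} {y′} eq with x Fin.<? y | x′ Fin.<? y′ | eq
... | yes _ | yes _ | refl = inj₁ (refl , refl)
... | yes _ | no  _ | refl = inj₂ (refl , refl)
... | no  _ | yes _ | refl = inj₂ (refl , refl)
... | no  _ | no  _ | refl = inj₁ (refl , refl)

-- By definition, the list whose length is the size of `F`.
edgeList : ∀ {n} → EdgeSet n → List (Fin n × Fin n)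
edgeList {n} F = filter (λ (u , v) → (u Fin.<? v) ×-dec T? (has F u v)) (cartesianProduct (allFin n) (allFin n))

edgeList-unique : ∀ {n} (F : EdgeSet n) → Unique (edgeList F)
edgeList-unique {n} F = filter⁺ _ (cartesianProduct⁺ (allFin⁺ n) (allFin⁺ n))

edgeList⁻ : ∀ {n} (F : EdgeSet n) {x y} → (x , y) ∈ edgeList F → x Fin.< y × Bool.T (has F x y)
edgeList⁻ F i = proj₂ (∈-filter⁻ (λ (u , v) → (u Fin.<? v) ×-dec T? (has F u v)) {xs = cartesianProduct (allFin _) (allFin _)} i)

edgeList⁺ : ∀ {n} (F : EdgeSet n) {x y} → Bool.T (has F x y) → normal x y ∈ edgeList F
edgeList⁺ {n} F {x} {y} f with Fin.<-cmp x y
... | tri< x<y _ _ rewrite normal-< x<y =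
  ∈-filter⁺ (λ (u , v) → (u Fin.<? v) ×-dec T? (has F u v)) (∈-cartesianProduct⁺ (∈-allFin x) (∈-allFin y)) (x<y , f)
... | tri≈ _ refl _ = contradiction (subst Bool.T (EdgeSet.irrefl F x) f) λ ()
... | tri> _ _ y<x rewrite normal-> y<x =
  ∈-filter⁺ (λ (u , v) → (u Fin.<? v) ×-dec T? (has F u v)) (∈-cartesianProduct⁺ (∈-allFin y) (∈-allFin x))
    (y<x , subst Bool.T (EdgeSet.sym F x y) f)

allPairs-map : ∀ {X : Set} {P : X → Set} {R S : X → X → Set} {xs} →
               (∀ {x y} → P x → P y → R x y → S x y) → All P xs → AllPairs R xs → AllPairs S xs
allPairs-map f []       []       = []
allPairs-map f (p ∷ ps) (r ∷ rs) = All.map (λ { (q , s) → f p q s }) (All.zip (ps , r)) ∷ allPairs-map f ps rs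

T-∧-not⁺ : ∀ {a b} → Bool.T a → ¬ Bool.T b → Bool.T (a ∧ not b)
T-∧-not⁺ {true} {true}  _ ¬b = ¬b _
T-∧-not⁺ {true} {false} _ _  = _

T-∧-not⁻ : ∀ {a b} → Bool.T (a ∧ not b) → Bool.T a × ¬ Bool.T b
T-∧-not⁻ {true} {false} _ = _ , λ ()

-- Separating two vertices to distance three

module Detours (G : Graph) where
  open Graph G using (Adjacent)

  E : EdgeSet (order G)
  E = edges G

  adjacent-sym : ∀ {u v} → Adjacent u v → Adjacent v u
  adjacent-sym {u} {v} = subst Bool.T (EdgeSet.sym E u v)

  loopless : ∀ {u v} → Adjacent u v → u ≢ v
  loopless {u} a refl = subst Bool.T (EdgeSet.irrefl E u) a

  Common : Vertex G → Vertex G → Vertex G → Set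
  Common u v w = Bool.T (has E u w ∧ has E w v)

  common? : ∀ u v w → Dec (Common u v w)
  common? u v w = T? (has E u w ∧ has E w v)

  common⁻ : ∀ {u v w} → Common u v w → Adjacent u w × Adjacent w v
  common⁻ = Equivalence.to T-∧

  commons : Vertex G → Vertex G → List (Vertex G)
  commons u v = filter (common? u v) (allFin (order G))

  deletions : Vertex G → Vertex G → ℕ
  deletions u v = length (commons u v) + (if has E u v then 1 else 0)

  record Detour (k : ℕ) : Set where
    field
      {u a b v} : Vertex G
      ua : Adjacent u a
      ab : Adjacent a b
      bv : Adjacent b v
      u≢v : u ≢ v
      u≢b : u ≢ b
      a≢v : a ≢ v
      deletions≤k : deletions u v ≤ k

  -- Every common neighbour w of u and v loses its edge to χ w, which is u or v.

  module Cut {u v : Vertex G} (u≢v : u ≢ v) (χ : Vertex G → Vertex G) (χ-end : ∀ w → χ w ≡ u ⊎ χ w ≡ v) where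

    spokes ends cut : List (Vertex G × Vertex G)
    spokes = List.map (λ w → normal (χ w) w) (commons u v)
    ends   = if has E u v then normal u v ∷ [] else []
    cut    = spokes ++ ends

    length-cut : length cut ≡ deletions u v
    length-cut = trans (length-++ spokes) (cong₂ _+_ (length-map _ (commons u v)) (length-ends (has E u v)))
      where
      length-ends : ∀ b → length (if b then normal u v ∷ [] else []) ≡ (if b then 1 else 0)
      length-ends true  = refl
      length-ends false = refl

    not-end : ∀ {w w′} → Common u v w → w ≢ χ w′
    not-end {w} {w′} c w≡ with common⁻ c | χ-end w′
    ... | uw , wv | inj₁ χ≡u = loopless uw (sym (trans w≡ χ≡u))
    ... | uw , wv | inj₂ χ≡v = loopless wv (trans w≡ χ≡v)

    ∈-spokes : ∀ {w} → Common u v w → normal (χ w) w ∈ cut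
    ∈-spokes {w} c = ∈-++⁺ˡ (∈-map⁺ (λ w → normal (χ w) w) (∈-filter⁺ (common? u v) (∈-allFin w) c))

    ∈-ends : Adjacent u v → normal u v ∈ cut
    ∈-ends uv with has E u v
    ... | true = ∈-++⁺ʳ spokes (here refl)

    ends⁻ : ∀ {e} → e ∈ ends → Adjacent u v × e ≡ normal u v
    ends⁻ i with has E u v
    ends⁻ (here refl) | true = _ , refl

    spokes⁻ : ∀ {e} → e ∈ spokes → ∃[ w ] Common u v w × e ≡ normal (χ w) w
    spokes⁻ i with ∈-map⁻ (λ w → normal (χ w) w) i
    ... | w , w∈ , eq = w , proj₂ (∈-filter⁻ (common? u v) {xs = allFin (order G)} w∈) , eq

    -- Two spokes could coincide only if a common neighbour were one of the ends, and so could a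
    -- spoke and `uv`; the absence of loops excludes this. Without repetitions, the length of `cut`
    -- bounds the size of any edge set containing it from below.
    cut-unique : Unique cut
    cut-unique = ++⁺ spokes-unique ends-unique disjoint
      where
      spokes-unique : Unique spokes
      spokes-unique = AllPairs.map⁺ (allPairs-map distinct
        (All.tabulate (λ i → proj₂ (∈-filter⁻ (common? u v) {xs = allFin (order G)} i)))
        (filter⁺ (common? u v) (allFin⁺ (order G))))
        where
        distinct : ∀ {w w′} → Common u v w → Common u v w′ → w ≢ w′ → normal (χ w) w ≢ normal (χ w′) w′
        distinct c c′ w≢w′ eq with normal-injective eq
        ... | inj₁ (_ , w≡w′)  = w≢w′ w≡w′
        ... | inj₂ (_ , w≡χw′) = not-end c w≡χw′
      ends-unique : Unique ends
      ends-unique with has E u v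
      ... | true  = [] ∷ []
      ... | false = []
      disjoint : ∀ {e} → ¬ (e ∈ spokes × e ∈ ends)
      disjoint (i , j) with spokes⁻ i | ends⁻ j
      ... | w , c , eq | _ , eq′ with common⁻ c | normal-injective (trans (sym eq) eq′)
      ...   | uw , wv | inj₁ (_ , w≡v) = loopless wv w≡v
      ...   | uw , wv | inj₂ (_ , w≡u) = loopless uw (sym w≡u)

  Solution : ℕ → Set
  Solution k = Σ (EdgeSet (order G)) λ F →
      F ⊆ E
    × ∣ F ∣ ≤ k
    × Connected (G − F)
    × (∃[ D ] IsDiameter (G − F) D × 3 ≤ D)

  -- From a path on four vertices to a solution

  module _ {k : ℕ} (conn : Connected G) (D : Detour k) where
    open Detour D

    χ : Vertex G → Vertex G
    χ w with w Fin.≟ a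
    ... | yes _ = v
    ... | no _  = u

    χ-a : χ a ≡ v
    χ-a with a Fin.≟ a
    ... | yes _ = refl
    ... | no a≢a = contradiction refl a≢a

    χ-other : ∀ {w} → w ≢ a → χ w ≡ u
    χ-other {w} w≢a with w Fin.≟ a
    ... | yes w≡a = contradiction w≡a w≢a
    ... | no _ = refl

    χ-end : ∀ w → χ w ≡ u ⊎ χ w ≡ v
    χ-end w with w Fin.≟ a
    ... | yes _ = inj₂ refl
    ... | no _  = inj₁ refl

    open Cut u≢v χ χ-end

    -- Oriented: in the second case `x` is the end of the cut and `y` the common neighbour. `F` is
    -- the symmetric closure.
    Removed : Vertex G → Vertex G → Set
    Removed x y = (x ≡ u × y ≡ v × Adjacent u v) ⊎ (x ≡ χ y × Common u v y)

    removed? : ∀ x y → Dec (Removed x y)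
    removed? x y = (x Fin.≟ u ×-dec y Fin.≟ v ×-dec T? (has E u v))
             ⊎-dec (x Fin.≟ χ y ×-dec common? u v y)

    χ-adjacent : ∀ {w} → Common u v w → Adjacent (χ w) w
    χ-adjacent {w} c with common⁻ c | χ-end w
    ... | uw , wv | inj₁ χ≡u = subst (λ x → Adjacent x w) (sym χ≡u) uw
    ... | uw , wv | inj₂ χ≡v = subst (λ x → Adjacent x w) (sym χ≡v) (adjacent-sym wv)

    removed-adjacent : ∀ {x y} → Removed x y → Adjacent x y
    removed-adjacent (inj₁ (refl , refl , uv)) = uv
    removed-adjacent (inj₂ (refl , c))         = χ-adjacent c

    F : EdgeSet (order G)
    F = record
      { has    = λ x y → isYes (removed? x y) ∨ isYes (removed? y x)
      ; sym    = λ x y → ∨-comm (isYes (removed? x y)) (isYes (removed? y x))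
      ; irrefl = irrefl
      }
      where
      irrefl : ∀ x → isYes (removed? x x) ∨ isYes (removed? x x) ≡ false
      irrefl x with removed? x x
      ... | yes r = contradiction refl (loopless (removed-adjacent r))
      ... | no _  = refl

    F⁻ : ∀ {x y} → Bool.T (has F x y) → Removed x y ⊎ Removed y x
    F⁻ {x} {y} f with Equivalence.to (T-∨ {isYes (removed? x y)} {isYes (removed? y x)}) f
    ... | inj₁ t = inj₁ (toWitness {a? = removed? x y} t)
    ... | inj₂ t = inj₂ (toWitness {a? = removed? y x} t)

    F⁺ : ∀ {x y} → Removed x y → Bool.T (has F x y)
    F⁺ {x} {y} r = Equivalence.from (T-∨ {isYes (removed? x y)} {isYes (removed? y x)}) (inj₁ (fromWitness {a? = removed? x y} r))

    F⊆E : F ⊆ E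
    F⊆E x y f with F⁻ f
    ... | inj₁ r = removed-adjacent r
    ... | inj₂ r = adjacent-sym (removed-adjacent r)

    removed-cut : ∀ {x y} → Removed x y → normal x y ∈ cut
    removed-cut (inj₁ (refl , refl , uv)) = ∈-ends uv
    removed-cut (inj₂ (refl , c))         = ∈-spokes c

    ∣F∣≤k : ∣ F ∣ ≤ k
    ∣F∣≤k = ≤-trans (unique-length≤ (edgeList-unique F) in-cut)
                    (≤-trans (≤-reflexive length-cut) deletions≤k)
      where
      in-cut : ∀ {e} → e ∈ edgeList F → e ∈ cut
      in-cut {x , y} i with edgeList⁻ F i
      ... | x<y , f with F⁻ f
      ...   | inj₁ r = subst (_∈ cut) (normal-< x<y) (removed-cut r)
      ...   | inj₂ r = subst (_∈ cut) (normal-> x<y) (removed-cut r)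

    H : Graph
    H = G − F

    kept : ∀ {x y} → Adjacent x y → ¬ Removed x y → ¬ Removed y x → Graph.Adjacent H x y
    kept xy ¬r ¬r′ = T-∧-not⁺ xy ([ ¬r , ¬r′ ]′ ∘ F⁻)

    H-sym : ∀ {x y} → Graph.Adjacent H x y → Graph.Adjacent H y x
    H-sym {x} {y} = subst Bool.T (EdgeSet.sym (edges H) x y)

    -- The three path edges survive because `χ` sends `a` to `v` but `b` to `u`, and because neither
    -- end of the middle edge is `u` or `v`.
    H-ua : Graph.Adjacent H u a
    H-ua = kept ua
      (λ { (inj₁ (_ , a≡v , _)) → a≢v a≡v ; (inj₂ (u≡χa , _)) → u≢v (trans u≡χa χ-a) })
      (λ { (inj₁ (a≡u , _)) → loopless ua (sym a≡u) ; (inj₂ (_ , c)) → loopless (proj₁ (common⁻ c)) refl })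

    H-ab : Graph.Adjacent H a b
    H-ab = kept ab
      (λ { (inj₁ (a≡u , _)) → loopless ua (sym a≡u) ; (inj₂ (a≡χ , _)) → interior b (loopless ua ∘ sym) a≢v a≡χ })
      (λ { (inj₁ (b≡u , _)) → u≢b (sym b≡u) ; (inj₂ (b≡χ , _)) → interior a (u≢b ∘ sym) (loopless bv) b≡χ })
      where
      interior : ∀ {x} w → x ≢ u → x ≢ v → x ≢ χ w
      interior w x≢u x≢v x≡χ with χ-end w
      ... | inj₁ χ≡u = x≢u (trans x≡χ χ≡u)
      ... | inj₂ χ≡v = x≢v (trans x≡χ χ≡v)

    H-bv : Graph.Adjacent H b v
    H-bv = kept bv
      (λ { (inj₁ (b≡u , _)) → u≢b (sym b≡u) ; (inj₂ (_ , c)) → loopless (proj₂ (common⁻ c)) refl })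
      (λ { (inj₁ (v≡u , _)) → u≢v (sym v≡u)
         ; (inj₂ (v≡χb , _)) → u≢v (sym (trans v≡χb (χ-other (loopless ab ∘ sym)))) })

    H-yv : ∀ {y} → y ≢ a → Common u v y → Graph.Adjacent H y v
    H-yv y≢a c = kept (proj₂ (common⁻ c))
      (λ { (inj₁ (y≡u , _)) → loopless (proj₁ (common⁻ c)) (sym y≡u)
         ; (inj₂ (_ , c′)) → loopless (proj₂ (common⁻ c′)) refl })
      (λ { (inj₁ (v≡u , _)) → u≢v (sym v≡u) ; (inj₂ (v≡χy , _)) → u≢v (sym (trans v≡χy (χ-other y≢a))) })

    u⇝v : Walk H u v
    u⇝v = H-ua ◅ H-ab ◅ H-bv ◅ ε

    -- The spoke of `a` was cut at `v`, and `v b a` replaces it. Any other spoke was cut at `u`, so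
    -- its edge to `v` remains and prolongs the path `u a b v`.
    bypass : ∀ {x y} → Removed x y → Walk H x y
    bypass (inj₁ (refl , refl , _)) = u⇝v
    bypass {y = y} (inj₂ (refl , c)) with y Fin.≟ a
    ... | yes refl = H-sym H-bv ◅ H-sym H-ab ◅ ε
    ... | no y≢a   = u⇝v ◅◅ H-sym (H-yv y≢a c) ◅ ε

    transport : ∀ {x y} → Walk G x y → Walk H x y
    transport ε = ε
    transport {x} (_◅_ {j = y} e w) with removed? x y | removed? y x
    ... | yes r | _      = bypass r ◅◅ transport w
    ... | no _  | yes r  = reverse H-sym (bypass r) ◅◅ transport w
    ... | no ¬r | no ¬r′ = kept e ¬r ¬r′ ◅ transport w

    H-connected : Connected H
    H-connected x y = proj₁ (Distances.shortcut H (transport (Path.walk (conn x y))))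

    gone : ∀ x y → Removed x y → ¬ Graph.Adjacent H x y
    gone x y r xy = proj₂ (T-∧-not⁻ {has E x y} {has F x y} xy) (F⁺ r)

    H⊆G : ∀ x y → Graph.Adjacent H x y → Adjacent x y
    H⊆G x y xy = proj₁ (T-∧-not⁻ {has E x y} {has F x y} xy)

    far : (w : Walk H u v) → 3 ≤ edgeCount H w
    far ε                         = contradiction refl u≢v
    far (uv ◅ ε)                  = contradiction uv (gone u v (inj₁ (refl , refl , H⊆G u v uv)))
    far (_◅_ {j = w} uw (wv ◅ ε)) = contradiction₂ (w Fin.≟ a)
      where
      c : Common u v w
      c = Equivalence.from (T-∧ {has E u w} {has E w v}) (H⊆G u w uw , H⊆G w v wv)
      -- What the goal becomes for a walk of two edges; it follows from absurdity, since one of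
      -- these edges was deleted.
      contradiction₂ : Dec (w ≡ a) → 3 ≤ 2
      contradiction₂ (yes refl) = contradiction (H-sym {w} {v} wv) (gone v w (inj₂ (sym χ-a , c)))
      contradiction₂ (no w≢a)   = contradiction uw (gone u w (inj₂ (sym (χ-other w≢a) , c)))
    far (_ ◅ _ ◅ _ ◅ _)           = s≤s (s≤s (s≤s z≤n))

    far-distance : ∀ {d} → IsDistance H u v d → 3 ≤ d
    far-distance ((p , refl) , _) = far (Path.walk p)

    solution : Solution k
    solution = F , F⊆E , ∣F∣≤k , H-connected , proj₁ diam , proj₂ diam ,
      ≤-trans (far-distance (proj₂ dist)) (proj₂ (proj₂ diam) u v (proj₁ dist) (proj₂ dist))
      where
      diam = Distances.diameter H H-connected
      dist = Distances.distance H (H-connected u v)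

  -- From a solution to a path on four vertices

  module _ {F : EdgeSet (order G)} where

    H′ : Graph
    H′ = G − F

    Geodesic : ∀ {x y} → Walk H′ x y → Set
    Geodesic {x} {y} w = ∀ (w′ : Walk H′ x y) → edgeCount H′ w ≤ edgeCount H′ w′

    -- The last three edges of a geodesic form a geodesic.

    detour : ∀ {k x y} (w : Walk H′ x y) → 3 ≤ edgeCount H′ w → Geodesic w → ∣ F ∣ ≤ k → Detour k
    detour (_ ◅ ε)     (s≤s ())
    detour (_ ◅ _ ◅ ε) (s≤s (s≤s ()))
    -- A walk shorter than `w` would, after `e`, give a walk shorter than the geodesic.
    detour (e ◅ w@(_ ◅ _ ◅ _ ◅ _)) _ geo F≤k =
      detour w (s≤s (s≤s (s≤s z≤n))) (λ w′ → s≤s⁻¹ (geo (e ◅ w′))) F≤k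
    detour {x = u} {y = v} (_◅_ {j = a} ua (_◅_ {j = b} ab (bv ◅ ε))) _ geo F≤k = record
      { ua = H′⊆G {u} {a} ua ; ab = H′⊆G {a} {b} ab ; bv = H′⊆G {b} {v} bv
      ; u≢v = u≢v
      -- If `u` were `b`, or `a` were `v`, a single edge would join the ends of a geodesic of length
      -- 3.
      ; u≢b = λ { refl → contradiction (geo (bv ◅ ε)) λ { (s≤s ()) } }
      ; a≢v = λ { refl → contradiction (geo (ua ◅ ε)) λ { (s≤s ()) } }
      ; deletions≤k = ≤-trans (≤-reflexive (sym length-cut)) (≤-trans (unique-length≤ cut-unique in-F) F≤k)
      }
      where
      H′⊆G : ∀ {x y} → Graph.Adjacent H′ x y → Adjacent x y
      H′⊆G {x} {y} xy = proj₁ (T-∧-not⁻ {has E x y} {has F x y} xy)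
      H′⁺ : ∀ {x y} → Adjacent x y → ¬ Bool.T (has F x y) → Graph.Adjacent H′ x y
      H′⁺ = T-∧-not⁺
      u≢v : u ≢ v
      u≢v refl = contradiction (geo ε) λ ()
      -- The end is chosen so that the edge is certainly in `F`: if `F` spares the edge from `u` to
      -- `w`, it must contain the one from `w` to `v`, or two edges would join `u` to `v`.
      ψ : Vertex G → Vertex G
      ψ w = if has F u w then u else v
      ψ-end : ∀ w → ψ w ≡ u ⊎ ψ w ≡ v
      ψ-end w with has F u w
      ... | true  = inj₁ refl
      ... | false = inj₂ refl
      open Cut u≢v ψ ψ-end
      uv∈F : Adjacent u v → Bool.T (has F u v)
      uv∈F uv with T? (has F u v)
      ... | yes f = f
      ... | no ¬f = contradiction (geo (H′⁺ uv ¬f ◅ ε)) λ { (s≤s ()) }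
      ψ∈F : ∀ w → Common u v w → Bool.T (has F (ψ w) w)
      ψ∈F w c with has F u w in eq
      ... | true  = subst Bool.T (sym eq) _
      ... | false with T? (has F v w)
      ...   | yes f = f
      ...   | no ¬f = contradiction
        (geo (H′⁺ (proj₁ (common⁻ c)) (subst Bool.T eq) ◅
              H′⁺ (proj₂ (common⁻ c)) (¬f ∘ subst Bool.T (EdgeSet.sym F w v)) ◅ ε))
        λ { (s≤s (s≤s ())) }
      in-F : ∀ {e} → e ∈ cut → e ∈ edgeList F
      in-F i with ∈-++⁻ spokes i
      ... | inj₁ j with spokes⁻ j
      ...   | w , c , refl = edgeList⁺ F (ψ∈F w c)
      in-F i | inj₂ j with ends⁻ j
      ...   | uv , refl = edgeList⁺ F (uv∈F uv)

  solution⇒detour : ∀ {k} → Solution k → Detour k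
  solution⇒detour (F , _ , F≤k , _ , D , ((u , v , isDist@((p , refl) , _)) , _) , 3≤D) =
    detour {F} (Path.walk p) 3≤D (Distances.distance-≤-walk (G − F) isDist) F≤k



-- Addresses in the encoding, and sums as counts

open Programs 3 10 using (machine; runs; time; time-poly)
open Decider using (main; accepts; nth; total; isOne)

nth-++ : ∀ {X : Set} {d : X} xs ys i → nth d (xs ++ ys) (length xs + i) ≡ nth d ys i
nth-++ []       ys i = refl
nth-++ (x ∷ xs) ys i = nth-++ xs ys i

nth-replicate : ∀ {X : Set} {d : X} m x ys {i} → i < m → nth d (List.replicate m x ++ ys) i ≡ x
nth-replicate (suc m) x ys {zero}  _       = refl
nth-replicate (suc m) x ys {suc i} (s≤s l) = nth-replicate m x ys l

nth-tabulate : ∀ {X : Set} {d : X} {n} (f : Fin n → X) ys i → nth d (tabulate f ++ ys) (toℕ i) ≡ f i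
nth-tabulate f ys zero    = refl
nth-tabulate f ys (suc i) = nth-tabulate (f ∘ suc) ys i

-- Row-major order: every step of the first coordinate skips a block of `l` entries.
nth-product : ∀ {X Y Z : Set} {d : Z} (g : X × Y → Z) {k l} (f : Fin k → X) (h : Fin l → Y) zs i j →
  nth d (List.map g (cartesianProduct (tabulate f) (tabulate h)) ++ zs) (l * toℕ i + toℕ j) ≡ g (f i , h j)
nth-product {X} {Y} {Z} {d} g {suc k} {l} f h zs i j =
  trans (cong (λ xs → nth d xs (l * toℕ i + toℕ j)) first-row) (go i)
  where
  row : List Z
  row = tabulate (λ j → g (f zero , h j))
  others : List Z
  others = List.map g (cartesianProduct (tabulate (f ∘ suc)) (tabulate h)) ++ zs
  first-row : List.map g (cartesianProduct (tabulate f) (tabulate h)) ++ zs ≡ row ++ others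
  first-row = begin
    List.map g (List.map (f zero ,_) (tabulate h) ++ _) ++ zs           ≡⟨ cong (_++ zs) (map-++ g (List.map (f zero ,_) (tabulate h)) _) ⟩
    (List.map g (List.map (f zero ,_) (tabulate h)) ++ List.map g _) ++ zs ≡⟨ ++-assoc (List.map g (List.map (f zero ,_) (tabulate h))) _ zs ⟩
    List.map g (List.map (f zero ,_) (tabulate h)) ++ others            ≡⟨ cong (λ r → List.map g r ++ others) (map-tabulate h (f zero ,_)) ⟩
    List.map g (tabulate (λ j → f zero , h j)) ++ others                ≡⟨ cong (_++ others) (map-tabulate (λ j → f zero , h j) g) ⟩
    row ++ others                                                       ∎
    where open ≡-Reasoning
  go : ∀ i → nth d (row ++ others) (l * toℕ i + toℕ j) ≡ g (f i , h j)
  go zero    = trans (cong (λ o → nth d (row ++ others) (o + toℕ j)) (*-zeroʳ l)) (nth-tabulate _ others j)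
  go (suc i) = begin
    nth d (row ++ others) (l * suc (toℕ i) + toℕ j)
      ≡⟨ cong (nth d (row ++ others)) (trans (cong (_+ toℕ j) (*-suc l (toℕ i))) (+-assoc l _ _)) ⟩
    nth d (row ++ others) (l + (l * toℕ i + toℕ j))
      ≡⟨ cong (λ o → nth d (row ++ others) (o + (l * toℕ i + toℕ j))) (length-tabulate (λ j → g (f zero , h j))) ⟨
    nth d (row ++ others) (length row + (l * toℕ i + toℕ j))
      ≡⟨ nth-++ row others _ ⟩
    nth d others (l * toℕ i + toℕ j)
      ≡⟨ nth-product g (f ∘ suc) h zs i j ⟩
    g (f (suc i) , h j) ∎
    where open ≡-Reasoning

length-cartesianProduct : ∀ {X Y : Set} (xs : List X) (ys : List Y) →
                          length (cartesianProduct xs ys) ≡ length xs * length ys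
length-cartesianProduct []       ys = refl
length-cartesianProduct (x ∷ xs) ys =
  trans (length-++ (List.map (x ,_) ys)) (cong₂ _+_ (length-map (x ,_) ys) (length-cartesianProduct xs ys))

-- `total` splits off its last summand, but recursion over `Fin` needs the first.
total-first : ∀ n m → total (suc n) m ≡ m 1 + total n (m ∘ suc)
total-first zero    m = refl
total-first (suc n) m = begin
  m (2 + n) + total (suc n) m                  ≡⟨ cong (m (2 + n) +_) (total-first n m) ⟩
  m (2 + n) + (m 1 + total n (m ∘ suc))        ≡⟨ swap (m (2 + n)) (m 1) (total n (m ∘ suc)) ⟩
  m 1 + total (suc n) (m ∘ suc)                ∎
  where
  open ≡-Reasoning
  swap : ∀ a b c → a + (b + c) ≡ b + (a + c)
  swap = solve-∀

total-filter : ∀ {X : Set} {P : X → Set} (P? : ∀ x → Dec (P x)) n (m : ℕ → ℕ) (f : Fin n → X) →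
               (∀ i → m (suc (toℕ i)) ≡ (if does (P? (f i)) then 1 else 0)) →
               total n m ≡ length (filter P? (tabulate f))
total-filter P? zero    m f eq = refl
total-filter P? (suc n) m f eq =
  trans (total-first n m)
        (trans (cong₂ _+_ (eq zero) (total-filter P? n (m ∘ suc) (f ∘ suc) (eq ∘ suc))) counted)
  where
  counted : (if does (P? (f zero)) then 1 else 0) + length (filter P? (tabulate (f ∘ suc)))
          ≡ length (filter P? (tabulate f))
  counted with does (P? (f zero))
  ... | true  = refl
  ... | false = refl

-- With a continuation, so that `sound` can unfold the nested sums of `findings` one inside the
-- other.
total-positive⁻ : ∀ {R : Set} n m → (∀ (i : Fin n) → 0 < m (suc (toℕ i)) → R) → 0 < total n m → R
total-positive⁻ (suc n) m r pos with m 1 in eq | subst (0 <_) (total-first n m) pos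
... | suc _ | _    = r zero (subst (0 <_) (sym eq) z<s)
... | zero  | pos′ = total-positive⁻ n (m ∘ suc) (r ∘ suc) pos′

total-positive⁺ : ∀ n m (i : Fin n) → 0 < m (suc (toℕ i)) → 0 < total n m
total-positive⁺ (suc n) m zero    p = subst (0 <_) (sym (total-first n m)) (≤-trans p (m≤m+n (m 1) _))
total-positive⁺ (suc n) m (suc i) p =
  subst (0 <_) (sym (total-first n m)) (≤-trans (total-positive⁺ n (m ∘ suc) i p) (m≤n+m _ (m 1)))

if-positive⁻ : ∀ {R : Set} b {m} → (Bool.T b → 0 < m → R) → 0 < (if b then m else 0) → R
if-positive⁻ true r p = r _ p

if-positive⁺ : ∀ {b m} → Bool.T b → 0 < m → 0 < (if b then m else 0)
if-positive⁺ {true} _ p = p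

unless-positive⁻ : ∀ {R : Set} b {m} → (¬ Bool.T b → 0 < m → R) → 0 < (if b then 0 else m) → R
unless-positive⁻ false r p = r (λ ()) p

unless-positive⁺ : ∀ {b m} → ¬ Bool.T b → 0 < m → 0 < (if b then 0 else m)
unless-positive⁺ {true}  ¬b p = contradiction _ ¬b
unless-positive⁺ {false} ¬b p = p

Outcome : Programs.Prog 3 10 → (Programs.Heads 3 10 → Bool) → Set → List Bit → Set
Outcome p answer A bs = let open Run (machine p answer) in
  ∃[ t ] ∃[ b ] t ≤ time p (length bs) × (initial bs ⇓[ t ] b) × Reflects A b

-- Correctness of the decider on encoded instances

module Correctness (I : MDAInstance) where
  open MDAInstance I
  open Detours graph

  n m : ℕ
  n = order graph
  m = pred n

  suc-m : suc m ≡ n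
  suc-m = suc-pred n {{Graph.order≢0 graph}}

  0<n : 0 < n
  0<n = subst (0 <_) suc-m z<s

  matrixBits digits bits : List Bit
  matrixBits = encodeEdges (edges graph)
  digits     = encodeℕ k
  bits       = List.replicate m 1b ++ 0b ∷ matrixBits ++ digits

  encoding : encodeMDA I ≡ 1b ∷ bits
  encoding = trans (++-assoc (List.replicate n 1b) _ _)
                   (cong (λ j → List.replicate j 1b ++ 0b ∷ matrixBits ++ digits) (sym suc-m))

  length-matrix : length matrixBits ≡ n * n
  length-matrix = trans (length-map _ (cartesianProduct (allFin n) (allFin n)))
    (trans (length-cartesianProduct (allFin n) (allFin n))
           (cong₂ _*_ (length-tabulate {n = n} (λ i → i)) (length-tabulate {n = n} (λ i → i))))

  size : length bits ≡ n * suc n + length digits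
  size = begin
    length bits                                        ≡⟨ length-++ (List.replicate m 1b) ⟩
    length (List.replicate m 1b) + suc (length (matrixBits ++ digits))
      ≡⟨ cong₂ (λ a b → a + suc b) (length-replicate m) (length-++ matrixBits) ⟩
    m + suc (length matrixBits + length digits)        ≡⟨ +-suc m _ ⟩
    suc m + (length matrixBits + length digits)        ≡⟨ cong₂ (λ a b → a + (b + length digits)) suc-m length-matrix ⟩
    n + (n * n + length digits)                        ≡⟨ +-assoc n (n * n) (length digits) ⟨
    n + n * n + length digits                          ≡⟨ cong (_+ length digits) (*-suc n n) ⟨
    n * suc n + length digits                          ∎
    where open ≡-Reasoning

  cells tail : List (Symbol 3)
  cells = List.map bit bits
  tail  = List.map bit (matrixBits ++ digits)

  cells-split : cells ≡ List.replicate m (bit 1b) ++ bit 0b ∷ tail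
  cells-split = trans (map-++ bit (List.replicate m 1b) _) (cong (_++ bit 0b ∷ tail) (map-replicate bit m 1b))

  nth-cells : ∀ i → nth blank cells (m + i) ≡ nth blank (bit 0b ∷ tail) i
  nth-cells i = begin
    nth blank cells (m + i)                                        ≡⟨ cong (λ c → nth blank c (m + i)) cells-split ⟩
    nth blank (ones ++ bit 0b ∷ tail) (m + i)
      ≡⟨ cong (λ l → nth blank (ones ++ bit 0b ∷ tail) (l + i)) (length-replicate m) ⟨
    nth blank (ones ++ bit 0b ∷ tail) (length ones + i)            ≡⟨ nth-++ ones _ i ⟩
    nth blank (bit 0b ∷ tail) i                                    ∎
    where
    open ≡-Reasoning
    ones : List (Symbol 3)
    ones = List.replicate m (bit 1b)

  nth-after : ∀ i → nth blank cells (n + i) ≡ nth blank tail i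
  nth-after i = trans (cong (nth blank cells) (trans (cong (_+ i) (sym suc-m)) (sym (+-suc m i)))) (nth-cells (suc i))

  -- Taken to be what the machine reads at the computed address, so that the hypothesis `matrix`
  -- holds by `refl`; the graph enters through `adj-has`.
  adj : ℕ → ℕ → Bool
  adj x y = isOne (nth blank (aux zero ∷ cells) (n * x + y))

  adj-has : ∀ i j → adj (suc (toℕ i)) (suc (toℕ j)) ≡ has (edges graph) i j
  adj-has i j = trans (cong isOne symbol) (isOne-bit (has (edges graph) i j))
    where
    entry-bit : Fin n × Fin n → Symbol 3
    entry-bit (u , v) = bit (boolToBit (has (edges graph) u v))
    tail-split : tail ≡ List.map entry-bit (cartesianProduct (allFin n) (allFin n)) ++ List.map bit digits
    tail-split = trans (map-++ bit matrixBits digits)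
                       (cong (_++ List.map bit digits) (sym (map-∘ (cartesianProduct (allFin n) (allFin n)))))
    symbol : nth blank (aux zero ∷ cells) (n * suc (toℕ i) + suc (toℕ j)) ≡ entry-bit (i , j)
    symbol = begin
      nth blank (aux zero ∷ cells) (n * suc (toℕ i) + suc (toℕ j))
        ≡⟨ cong (nth blank (aux zero ∷ cells)) (trans (+-suc _ (toℕ j))
             (cong suc (trans (cong (_+ toℕ j) (*-suc n (toℕ i))) (+-assoc n _ _)))) ⟩
      nth blank cells (n + (n * toℕ i + toℕ j))                     ≡⟨ nth-after (n * toℕ i + toℕ j) ⟩
      nth blank tail (n * toℕ i + toℕ j)                            ≡⟨ cong (λ t → nth blank t (n * toℕ i + toℕ j)) tail-split ⟩
      nth blank (List.map entry-bit (cartesianProduct (allFin n) (allFin n)) ++ List.map bit digits) (n * toℕ i + toℕ j)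
        ≡⟨ nth-product entry-bit (λ i → i) (λ j → j) (List.map bit digits) i j ⟩
      entry-bit (i , j)                                             ∎
      where open ≡-Reasoning
    isOne-bit : ∀ b → isOne (bit (boolToBit b)) ≡ b
    isOne-bit true  = refl
    isOne-bit false = refl

  ones-before : ∀ i → suc i < n → nth blank cells i ≡ bit 1b
  ones-before i l = trans (cong (λ c → nth blank c i) cells-split)
    (nth-replicate m (bit 1b) _ (s≤s⁻¹ (subst (suc i <_) (sym suc-m) l)))

  separator : nth blank (aux zero ∷ cells) n ≡ bit 0b
  separator = subst (λ j → nth blank (aux zero ∷ cells) j ≡ bit 0b) suc-m
    (trans (cong (nth blank cells) (sym (+-identityʳ m))) (nth-cells 0))

  suffix : ∀ i → nth blank cells (n * suc n + i) ≡ nth blank (List.map bit digits) i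
  suffix i = begin
    nth blank cells (n * suc n + i)          ≡⟨ cong (nth blank cells) (trans (cong (_+ i) (*-suc n n)) (+-assoc n _ i)) ⟩
    nth blank cells (n + (n * n + i))        ≡⟨ nth-after (n * n + i) ⟩
    nth blank tail (n * n + i)
      ≡⟨ cong₂ (λ t l → nth blank t (l + i)) (map-++ bit matrixBits digits)
               (sym (trans (length-map bit matrixBits) length-matrix)) ⟩
    nth blank (List.map bit matrixBits ++ List.map bit digits) (length (List.map bit matrixBits) + i)
      ≡⟨ nth-++ (List.map bit matrixBits) _ i ⟩
    nth blank (List.map bit digits) i        ∎
    where open ≡-Reasoning

  open Decider.Semantics n bits digits adj 0<n size ones-before separator (λ _ _ _ _ _ _ → refl) suffix
    using (L; common; cost; findings; executes; accepts-sgn; input)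

  budget : ℕ
  budget = n ⊓ fromDigits digits

  found : ℕ
  found = findings (m⊓n≤m n (fromDigits digits))

  cost-deletions : ∀ u v → cost (suc (toℕ u)) (suc (toℕ v)) ≡ deletions u v
  cost-deletions u v = cong₂ _+_
    (total-filter (common? u v) n _ (λ i → i) λ w →
      trans (cong₂ (λ a b → if a then (if b then 1 else 0) else 0) (adj-has u w) (adj-has w v))
            (nested (has (edges graph) u w)))
    (cong (λ b → if b then 1 else 0) (adj-has u v))
    where
    nested : ∀ a {b} → (if a then (if b then 1 else 0) else 0) ≡ (if a ∧ b then 1 else 0)
    nested true  = refl
    nested false = refl

  -- u is not a neighbour of itself, so at most n − 1 common neighbours exist.

  deletions≤n : ∀ u v → deletions u v ≤ n
  deletions≤n u v = begin
    length (commons u v) + (if has E u v then 1 else 0)   ≤⟨ +-monoʳ-≤ (length (commons u v)) (at-most-one (has E u v)) ⟩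
    length (commons u v) + 1                              ≡⟨ +-comm (length (commons u v)) 1 ⟩
    length (u ∷ commons u v)                              ≤⟨ unique-length≤ {ys = allFin n}
                                                               (All.tabulate fresh ∷ filter⁺ (common? u v) (allFin⁺ n))
                                                               (λ _ → ∈-allFin _) ⟩
    length (allFin n)                                     ≡⟨ length-tabulate {n = n} (λ i → i) ⟩
    n                                                     ∎
    where
    open ≤-Reasoning
    at-most-one : ∀ b → (if b then 1 else 0) ≤ 1
    at-most-one true  = ≤-refl
    at-most-one false = z≤n
    fresh : ∀ {w} → w ∈ commons u v → u ≢ w
    fresh i = loopless (proj₁ (common⁻ (proj₂ (∈-filter⁻ (common? u v) {xs = allFin n} i))))

  budget-k : fromDigits digits ≡ k
  budget-k = proj₂ (toDigits 2 k)

  adj⁻ : ∀ {i j} → Bool.T (adj (suc (toℕ i)) (suc (toℕ j))) → Graph.Adjacent graph i j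
  adj⁻ {i} {j} = subst Bool.T (adj-has i j)

  adj⁺ : ∀ {i j} → Graph.Adjacent graph i j → Bool.T (adj (suc (toℕ i)) (suc (toℕ j)))
  adj⁺ {i} {j} = subst Bool.T (sym (adj-has i j))

  differ⁻ : ∀ {i j : Fin n} → ¬ Bool.T (toℕ i ≡ᵇ toℕ j) → i ≢ j
  differ⁻ {i} ne refl = ne (≡⇒≡ᵇ (toℕ i) (toℕ i) refl)

  differ⁺ : ∀ {i j : Fin n} → i ≢ j → ¬ Bool.T (toℕ i ≡ᵇ toℕ j)
  differ⁺ {i} {j} i≢j t = i≢j (Fin.toℕ-injective (≡ᵇ⇒≡ (toℕ i) (toℕ j) t))

  sound : 0 < found → Detour k
  sound =
    total-positive⁻ n _ λ u → total-positive⁻ n _ λ v → total-positive⁻ n _ λ a → total-positive⁻ n _ λ b →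
    if-positive⁻ (adj (suc (toℕ u)) (suc (toℕ a))) λ ua →
    if-positive⁻ (adj (suc (toℕ a)) (suc (toℕ b))) λ ab →
    if-positive⁻ (adj (suc (toℕ b)) (suc (toℕ v))) λ bv →
    unless-positive⁻ (toℕ u ≡ᵇ toℕ v) λ u≢v →
    unless-positive⁻ (toℕ u ≡ᵇ toℕ b) λ u≢b →
    unless-positive⁻ (toℕ a ≡ᵇ toℕ v) λ a≢v →
    if-positive⁻ (cost (suc (toℕ u)) (suc (toℕ v)) ≤ᵇ budget) λ cheap _ → record
      { ua = adj⁻ ua ; ab = adj⁻ ab ; bv = adj⁻ bv
      ; u≢v = differ⁻ u≢v ; u≢b = differ⁻ u≢b ; a≢v = differ⁻ a≢v
      ; deletions≤k = begin
          deletions u v                         ≡⟨ cost-deletions u v ⟨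
          cost (suc (toℕ u)) (suc (toℕ v))      ≤⟨ ≤ᵇ⇒≤ _ budget cheap ⟩
          budget                                ≤⟨ m⊓n≤n n (fromDigits digits) ⟩
          fromDigits digits                     ≡⟨ budget-k ⟩
          k                                     ∎
      }
    where open ≤-Reasoning

  complete : Detour k → 0 < found
  complete D =
    total-positive⁺ n _ u (total-positive⁺ n _ v (total-positive⁺ n _ a (total-positive⁺ n _ b
      (if-positive⁺ (adj⁺ ua) (if-positive⁺ (adj⁺ ab) (if-positive⁺ (adj⁺ bv)
        (unless-positive⁺ (differ⁺ u≢v) (unless-positive⁺ (differ⁺ u≢b) (unless-positive⁺ (differ⁺ a≢v)
          (if-positive⁺ (≤⇒≤ᵇ cheap) z<s))))))))))
    where
    open Detour D
    -- The cut-off of the budget loses nothing, because `deletions≤n` bounds the cost by `n` anyway.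
    cheap : cost (suc (toℕ u)) (suc (toℕ v)) ≤ budget
    cheap = subst (_≤ budget) (sym (cost-deletions u v))
      (⊓-glb (deletions≤n u v) (≤-trans deletions≤k (≤-reflexive (sym budget-k))))

  registers : Vec ℕ 11
  registers = 0 ∷ 0 ∷ 0 ∷ 0 ∷ 0 ∷ 0 ∷ 0 ∷ 0 ∷ 0 ∷ budget ∷ Decider.sgn found ∷ []

  not-zero⁻ : ∀ {x} → Bool.T (not (x ≡ᵇ 0)) → 0 < x
  not-zero⁻ {suc _} _ = z<s

  not-zero⁺ : ∀ {x} → 0 < x → Bool.T (not (x ≡ᵇ 0))
  not-zero⁺ {suc _} _ = _

  correct : Reflects (Solution k) (not (found ≡ᵇ 0))
  correct = fromEquivalence (solution connected ∘ sound ∘ not-zero⁻) (not-zero⁺ ∘ complete ∘ solution⇒detour)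

  2≤length : 2 ≤ length (encodeMDA I)
  2≤length = subst (2 ≤_) (sym (cong length encoding)) (s≤s (begin
    1                              ≤⟨ 0<n ⟩
    n                              ≤⟨ m≤m*n n (suc n) ⟩
    n * suc n                      ≤⟨ m≤m+n _ _ ⟩
    n * suc n + length digits      ≡⟨ size ⟨
    length bits                    ∎))
    where open ≤-Reasoning

  outcome : Outcome main accepts (Solution k) (encodeMDA I)
  outcome = subst (Outcome main accepts (Solution k)) (sym encoding)
    (proj₁ run , _ , proj₁ (proj₂ run) , runs main accepts (proj₂ (proj₂ run)) ,
     subst (Reflects (Solution k)) (sym (accepts-sgn {registers} found refl)) correct)
    where
    run = Programs.steps 3 10 executes

-- The polynomial time bound

-- Replaces the base `suc L` of `time-poly` by the length of the input, at the price of doubling the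
-- degree.
suc≤^2 : ∀ {l} → 2 ≤ l → suc l ≤ l ^ 2
suc≤^2 {l} 2≤l = begin
  suc l          ≤⟨ +-monoˡ-≤ l (≤-trans (s≤s z≤n) 2≤l) ⟩
  l + l          ≡⟨ cong (l +_) (+-identityʳ l) ⟨
  2 * l          ≤⟨ *-monoˡ-≤ l 2≤l ⟩
  l * l          ≡⟨ cong (l *_) (*-identityʳ l) ⟨
  l ^ 2          ∎
  where open ≤-Reasoning

decides-in-polynomial-time : ∀ (P : DecisionProblem) p answer → let open DecisionProblem P in
  (∀ x → 2 ≤ length (encode x)) → (∀ x → Outcome p answer (Yes x) (encode x)) → PolynomialTime P
decides-in-polynomial-time P p answer long outcome with time-poly p
... | a , e , time≤ = machine p answer , a , 2 * e , λ x →
  let t , b , t≤ , run , reflects = outcome x in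
  t , b , ≤-trans t≤ (within (length (encode x)) (long x)) , run , reflects
  where
  open DecisionProblem P
  open ≤-Reasoning
  within : ∀ l → 2 ≤ l → time p l ≤ a * l ^ (2 * e) + a
  within l 2≤l = begin
    time p l               ≤⟨ time≤ l ⟩
    a * suc l ^ e          ≤⟨ *-monoʳ-≤ a (^-monoˡ-≤ e (suc≤^2 2≤l)) ⟩
    a * (l ^ 2) ^ e        ≡⟨ cong (a *_) (^-*-assoc l 2 e) ⟩
    a * l ^ (2 * e)        ≤⟨ m≤m+n _ a ⟩
    a * l ^ (2 * e) + a    ∎

theorem3p1 : PolynomialTime (MDA 3)
theorem3p1 = decides-in-polynomial-time (MDA 3) main accepts Correctness.2≤length Correctness.outcome
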